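{- The following problem is decidable: given a quantifier-free entailment $\varphi\vdash\{\varphi_i\}_{i\in I}$ ($I$ finite) of the symbolic-heap system with arrays and lists, decide whether it is valid, i.e. whether for all stores $s$ and heaps $h$, $s,h\models\varphi$ implies $s,h\models\varphi_i$ for some $i\in I$.
   Context: Terms: $t::=x\mid0\mid1\mid\cdots\mid t+t$, interpreted in $N$ by a store $s$ (variables to $N$, $s(n)=n$, $s(t+u)=s(t)+s(u)$). A heap is a finite partial function $h$ from $N\setminus\{0\}$ to $N^2$. A quantifier-free symbolic heap is $\Pi\land\Sigma$ where $\Pi$ is a Presburger formula and $\Sigma::=\mathrm{Emp}\mid t\mapsto(t,t)\mid\mathrm{Arr}(t,t)\mid\mathrm{ls}(t,t)\mid\mathrm{dll}(t,t,t,t)\mid\Sigma*\Sigma$. Satisfaction: pure formulas hold iff true under $s$; $s,h\models\mathrm{Emp}$ iff $\mathrm{Dom}(h)=\emptyset$; $s,h\models t\mapsto(u,v)$ iff $\mathrm{Dom}(h)=\{s(t)\}$ and $h(s(t))=(s(u),s(v))$; $s,h\models\mathrm{Arr}(t,u)$ iff $s(t)\le s(u)$ and $\mathrm{Dom}(h)=\{x\mid s(t)\le x\le s(u)\}$; $s,h\models F_1*F_2$ iff $h=h_1+h_2$ (disjoint union) with $s,h_i\models F_i$; $\land$ classical. $s,h\models\mathrm{ls}(t,u)$ iff $s,h\models\mathrm{ls}^k(t,u)$ for some $k\ge0$, and $s,h\models\mathrm{dll}(t,u,v,w)$ iff $s,h\models\mathrm{dll}^k(t,u,v,w)$ for some $k$,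 where $\mathrm{ls}^0,\mathrm{dll}^0$ are $0\neq0\land\mathrm{Emp}$, $\mathrm{ls}^{k+1}(t,u)=(t=u\land\mathrm{Emp})\lor\exists zw(t\mapsto(z,w)*\mathrm{ls}^k(z,u))$, $\mathrm{dll}^{k+1}(t,u,v,w)=(t=u\land v=w\land\mathrm{Emp})\lor\exists z(t\mapsto(z,w)*\mathrm{dll}^k(z,u,v,t))$. -}

module Defs where

open import Data.Nat using (ℕ; _+_; _≤_; _≟_)
open import Data.Product using (Σ; ∃; _×_; _,_)
open import Data.Sum using (_⊎_)
open import Data.Maybe using (Maybe; just; nothing)
open import Data.List using (List)
open import Data.List.Relation.Unary.Any using (Any)
open import Relation.Nullary using (¬_; yes; no)
open import Relation.Binary.PropositionalEquality using (_≡_)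

Var : Set
Var = ℕ

data Term : Set where
  var : Var → Term
  lit : ℕ → Term
  _⊕_ : Term → Term → Term

Store : Set
Store = Var → ℕ

⟦_⟧t : Term → Store → ℕ
⟦ var x ⟧t s = s x
⟦ lit n ⟧t s = n
⟦ t ⊕ u ⟧t s = ⟦ t ⟧t s + ⟦ u ⟧t s

_[_≔_] : Store → Var → ℕ → Store
(s [ x ≔ n ]) y with y ≟ x
... | yes _ = n
... | no _  = s y

data Pure : Set where
  _=ₚ_ : Term → Term → Pure
  _≤ₚ_ : Term → Term → Pure
  ¬ₚ_  : Pure → Pure
  _∧ₚ_ : Pure → Pure → Pure
  _∨ₚ_ : Pure → Pure → Pure
  ∃ₚ   : Var → Pure → Pure
  ∀ₚ   : Var → Pure → Pure

⟦_⟧p : Pure → Store → Set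
⟦ t =ₚ u ⟧p s = ⟦ t ⟧t s ≡ ⟦ u ⟧t s
⟦ t ≤ₚ u ⟧p s = ⟦ t ⟧t s ≤ ⟦ u ⟧t s
⟦ ¬ₚ P ⟧p s = ¬ ⟦ P ⟧p s
⟦ P ∧ₚ Q ⟧p s = ⟦ P ⟧p s × ⟦ Q ⟧p s
⟦ P ∨ₚ Q ⟧p s = ⟦ P ⟧p s ⊎ ⟦ Q ⟧p s
⟦ ∃ₚ x P ⟧p s = Σ ℕ λ n → ⟦ P ⟧p (s [ x ≔ n ])
⟦ ∀ₚ x P ⟧p s = (n : ℕ) → ⟦ P ⟧p (s [ x ≔ n ])

data Spatial : Set where
  Emp  : Spatial
  _↦⟨_,_⟩ : Term → Term → Term → Spatial
  Arr  : Term → Term → Spatial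
  ls   : Term → Term → Spatial
  dll  : Term → Term → Term → Term → Spatial
  _✶_  : Spatial → Spatial → Spatial

record QFSH : Set where
  constructor _∧ₛ_
  field
    pure    : Pure
    spatial : Spatial

RawHeap : Set
RawHeap = ℕ → Maybe (ℕ × ℕ)

record Heap : Set where
  field
    fun     : RawHeap
    zeroOut : fun 0 ≡ nothing
    finite  : ∃ λ b → ∀ x → b ≤ x → fun x ≡ nothing

open Heap public

_∈Dom_ : ℕ → RawHeap → Set
x ∈Dom h = ∃ λ p → h x ≡ just p

DisjUnion : RawHeap → RawHeap → RawHeap → Set
DisjUnion h h₁ h₂ = ∀ x →
  (h x ≡ h₁ x × h₂ x ≡ nothing) ⊎ (h x ≡ h₂ x × h₁ x ≡ nothing)

EmpSem : RawHeap → Set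
EmpSem h = ∀ x → h x ≡ nothing

PtsSem : ℕ → ℕ → ℕ → RawHeap → Set
PtsSem a b c h = h a ≡ just (b , c) × (∀ x → x ∈Dom h → x ≡ a)

ArrSem : ℕ → ℕ → RawHeap → Set
ArrSem a b h = a ≤ b × (∀ x → (x ∈Dom h → a ≤ x × x ≤ b) × (a ≤ x × x ≤ b → x ∈Dom h))

lsK : ℕ → ℕ → ℕ → RawHeap → Set
lsK 0 a b h = ¬ (0 ≡ 0) × EmpSem h
lsK (Data.Nat.suc k) a b h =
  (a ≡ b × EmpSem h) ⊎
  (Σ ℕ λ z → Σ ℕ λ w → Σ RawHeap λ h₁ → Σ RawHeap λ h₂ →
     DisjUnion h h₁ h₂ × PtsSem a z w h₁ × lsK k z b h₂)

dllK : ℕ → ℕ → ℕ → ℕ → ℕ → RawHeap → Set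
dllK 0 a b c d h = ¬ (0 ≡ 0) × EmpSem h
dllK (Data.Nat.suc k) a b c d h =
  (a ≡ b × c ≡ d × EmpSem h) ⊎
  (Σ ℕ λ z → Σ RawHeap λ h₁ → Σ RawHeap λ h₂ →
     DisjUnion h h₁ h₂ × PtsSem a z d h₁ × dllK k z b c a h₂)

_,_⊨ₛ_ : Store → RawHeap → Spatial → Set
s , h ⊨ₛ Emp = EmpSem h
s , h ⊨ₛ (t ↦⟨ u , v ⟩) = PtsSem (⟦ t ⟧t s) (⟦ u ⟧t s) (⟦ v ⟧t s) h
s , h ⊨ₛ Arr t u = ArrSem (⟦ t ⟧t s) (⟦ u ⟧t s) h
s , h ⊨ₛ ls t u = Σ ℕ λ k → lsK k (⟦ t ⟧t s) (⟦ u ⟧t s) h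
s , h ⊨ₛ dll t u v w =
  Σ ℕ λ k → dllK k (⟦ t ⟧t s) (⟦ u ⟧t s) (⟦ v ⟧t s) (⟦ w ⟧t s) h
s , h ⊨ₛ (F ✶ G) = Σ RawHeap λ h₁ → Σ RawHeap λ h₂ →
  DisjUnion h h₁ h₂ × (s , h₁ ⊨ₛ F) × (s , h₂ ⊨ₛ G)

_,_⊨_ : Store → Heap → QFSH → Set
s , h ⊨ (Π ∧ₛ Σ′) = ⟦ Π ⟧p s × (s , fun h ⊨ₛ Σ′)

Valid : QFSH → List QFSH → Set
Valid φ φs = (s : Store) (h : Heap) → s , h ⊨ φ → Any (λ ψ → s , h ⊨ ψ) φs

{-# OPTIONS --safe #-}

-- Validity is reduced to the truth of one Presburger sentence.
--
-- Let B exceed all terms of the entailment. In a model h of the antecedent, array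
-- contents and the second fields of ls cells can be replaced by the junk value B, and the
-- inner cells of a list segment by a single cell with a far address f > B. Every
-- conclusion satisfied by the resulting canonical heap H is satisfied by h: a junk first
-- field can only be covered by Arr, and f only by a list predicate running through the
-- whole segment. So ls unfolds to at most two cells and dll to at most three, and H is
-- given by finitely many terms.
--
-- H satisfies a conclusion iff, for some choice of the cells traversed by each list
-- predicate, the addresses and contents match and the regions claimed by the atoms
-- partition the domain of H; this is a Presburger condition.
--
-- Presburger arithmetic itself is decided with finite automata reading binary digits.
module Submission where

open import Defs
open import Algebra.Properties.CommutativeSemigroup using (interchange)
open import Data.Bool using (Bool; true; false; _xor_; _∧_; _∨_; if_then_else_)
import Data.Bool.Properties as Bool
open import Data.Empty using (⊥; ⊥-elim)
open import Data.Fin as Fin using (Fin; zero; suc; combine; remQuot; finToFun; funToFin; fromℕ<; toℕ; punchIn; punchOut)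
open import Data.Fin.Properties using (any?; remQuot-combine; finToFun-funToFin; toℕ-fromℕ<; punchIn-punchOut)
open import Data.Fin.Subset using (Subset; ∣_∣; _∪_; ⁅_⁆) renaming (_∈_ to _∈ˢ_)
open import Data.Fin.Subset.Properties
  using (_∈?_; p⊂q⇒∣p∣<∣q∣; p⊆p∪q; q⊆p∪q; x∈p∪q⁻; x∈⁅x⁆; x∈⁅y⁆⇒x≡y; ∣p∣≡n⇒p≡⊤; ∣p∣≤n; ∈⊤)
open import Data.List as List using (List; []; _∷_; _++_; allFin; cartesianProduct; cartesianProductWith)
open import Data.List.Membership.Propositional using (_∈_; find; lose)
open import Data.List.Membership.Propositional.Properties
  using (∈-allFin; ∈-cartesianProduct⁺; ∈-cartesianProductWith⁺; ∈-lookup)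
open import Data.List.Relation.Unary.Any as Any using (Any; here; there)
open import Data.List.Relation.Unary.Any.Properties using (++⁺ˡ; ++⁺ʳ; ++⁻; lookup-index)
open import Data.Maybe using (Maybe; just; nothing; _<∣>_)
open import Data.Maybe.Properties using (just-injective)
open import Data.Nat
open import Data.Nat.Properties
open import Data.Product as Prod using (Σ; ∃; ∃₂; _×_; _,_; proj₁; proj₂)
open import Data.Product.Properties using (,-injectiveˡ)
open import Data.Sum as Sum using (_⊎_; inj₁; inj₂; [_,_]′)
open import Data.Unit using (⊤; tt)
open import Data.Vec using (Vec; []; _∷_; lookup; zipWith; replicate; tabulate; head; tail)
open import Data.Vec.Properties using (lookup-zipWith; lookup∘tabulate; []=⇒lookup; lookup⇒[]=)
open import Function using (_∘_; id; _⇔_; mk⇔; Equivalence)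
open import Function.Construct.Composition using (_⇔-∘_)
open import Function.Construct.Identity using (⇔-id)
open import Function.Construct.Symmetry using (⇔-sym)
open import Relation.Nullary using (Dec; yes; no; ¬_)
open import Relation.Nullary.Decidable as Dec using (map′; _×-dec_; _⊎-dec_; ¬?; decidable-stable; does)
open import Relation.Binary.PropositionalEquality
  using (_≡_; _≢_; _≗_; refl; sym; trans; cong; cong₂; subst; subst₂)

open Equivalence using (to; from)

-- Presburger arithmetic

-- Satisfaction has to be transferred in one direction only. The canonical heap is itself a model of
-- the antecedent, under the same store, so a valid entailment supplies a conclusion for it, and
-- this conclusion only has to pass back from `H` to `h`. Hence the asymmetry of `Simulates`. The
-- value `B` works as junk because it is never an address of `H`: addresses named by terms lie below
-- `B`, and far addresses start at `B + 1`. A list predicate whose end lies below `B` can therefore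
-- neither stop at a junk pointer nor follow it. The lengths two and three come from the addresses
-- that terms can name. An `ls` names only its first cell, so all later cells can be merged into
-- one. A `dll` also names its last cell, which leaves a first cell, a merged middle and a last
-- cell. Shorter segments are separate cases, since all their addresses are named.

bit : Bool → ℕ → ℕ
bit false x = x + x
bit true  x = suc (x + x)

data Halved : ℕ → Set where
  halved : ∀ b k → Halved (bit b k)

halve : ∀ n → Halved n
halve zero = halved false zero
halve (suc n) with halve n
... | halved false k = halved true k
... | halved true  k = subst Halved (cong suc (+-suc k k)) (halved false (suc k))

bit-injective : ∀ b c {x y} → bit b x ≡ bit c y → b ≡ c × x ≡ y
bit-injective false false {x} {y} eq = refl , double-injective x y eq
  where
  double-injective : ∀ x y → x + x ≡ y + y → x ≡ y
  double-injective zero    zero    _  = refl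
  double-injective (suc x) (suc y) eq = cong suc (double-injective x y
    (suc-injective (trans (sym (+-suc x x)) (trans (suc-injective eq) (+-suc y y)))))
bit-injective true true eq = refl , proj₂ (bit-injective false false (suc-injective eq))
bit-injective false true {x} {y} eq = ⊥-elim (2*m≢1+2*n x y eq)
  where
  2*m≢1+2*n : ∀ x y → x + x ≢ suc (y + y)
  2*m≢1+2*n (suc x) y eq with trans (sym (+-suc x x)) (suc-injective eq)
  2*m≢1+2*n (suc x) (suc y) _ | eq′ = 2*m≢1+2*n x y (suc-injective (trans eq′ (cong suc (+-suc y y))))
bit-injective true false {x} {y} eq with bit-injective false true {y} {x} (sym eq)
... | ()

-- Halving fixes `0`, so recursion over the digits of a number runs on an upper bound instead. This
-- inequality makes the bound drop at each digit.
bit-≤ : ∀ b k {f} → bit b k ≤ suc f → k ≤ f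
bit-≤ _     zero    _       = z≤n
bit-≤ false (suc k) (s≤s p) = ≤-trans (≤-trans (m≤m+n (suc k) k) (≤-reflexive (sym (+-suc k k)))) p
bit-≤ true  (suc k) (s≤s p) = ≤-trans (m≤m+n (suc k) (suc k)) p

bits : ∀ {n} → Vec Bool n → Vec ℕ n → Vec ℕ n
bits = zipWith bit

zeros : ∀ n → Vec ℕ n
zeros n = replicate n 0

bits-zeros : ∀ n → bits (replicate n false) (zeros n) ≡ zeros n
bits-zeros zero    = refl
bits-zeros (suc n) = cong (0 ∷_) (bits-zeros n)

data Halvedᵛ {n} : Vec ℕ n → Set where
  halved : ∀ bs ks → Halvedᵛ (bits bs ks)

halveᵛ : ∀ {n} (v : Vec ℕ n) → Halvedᵛ v
halveᵛ [] = halved [] []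
halveᵛ (x ∷ v) with halve x | halveᵛ v
... | halved b k | halved bs ks = halved (b ∷ bs) (k ∷ ks)

-- A deterministic automaton reading tuples of numbers least significant bit first,
-- presented through the predicates accepted from its states.
record Automaton (n : ℕ) : Set₁ where
  field
    size    : ℕ
    Accepts : Fin size → Vec ℕ n → Set
    δ       : Fin size → Vec Bool n → Fin size
    step    : ∀ q bs v → Accepts q (bits bs v) ⇔ Accepts (δ q bs) v
    final?  : ∀ q → Dec (Accepts q (zeros n))

record Regular {n} (P : Vec ℕ n → Set) : Set₁ where
  field
    automaton : Automaton n
  open Automaton automaton public
  field
    start  : Fin size
    correct : ∀ v → P v ⇔ Accepts start v

module _ {n} (A : Automaton n) where
  open Automaton A

  private
    bounded : ∀ {m} → ℕ → Vec ℕ m → Set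
    bounded b v = ∀ i → lookup v i ≤ b

    bounded-zeros : ∀ {m} (v : Vec ℕ m) → bounded 0 v → v ≡ zeros m
    bounded-zeros []      _ = refl
    bounded-zeros (x ∷ v) p = cong₂ _∷_ (n≤0⇒n≡0 (p zero)) (bounded-zeros v (p ∘ suc))

    bounded-bits : ∀ {m b} (bs : Vec Bool m) ks → bounded (suc b) (bits bs ks) → bounded b ks
    bounded-bits bs ks p i = bit-≤ (lookup bs i) (lookup ks i) (subst (_≤ _) (lookup-zipWith bit i bs ks) (p i))

    bound : ∀ {m} (v : Vec ℕ m) → ∃ λ b → bounded b v
    bound []      = 0 , λ ()
    bound (x ∷ v) with bound v
    ... | b , p = x ⊔ b , λ { zero → m≤m⊔n x b ; (suc i) → ≤-trans (p i) (m≤n⊔m x b) }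

    -- When the bound reaches `0`, the remaining input is all zeros and `final?` decides.
    accepts?′ : ∀ b q v → bounded b v → Dec (Accepts q v)
    accepts?′ zero    q v p = subst (Dec ∘ Accepts q) (sym (bounded-zeros v p)) (final? q)
    accepts?′ (suc b) q v p with halveᵛ v
    ... | halved bs ks = map′ (from (step q bs ks)) (to (step q bs ks))
                           (accepts?′ b (δ q bs) ks (bounded-bits bs ks p))

  accepts? : ∀ q v → Dec (Accepts q v)
  accepts? q v = let b , p = bound v in accepts?′ b q v p

regular? : ∀ {n} {P : Vec ℕ n → Set} → Regular P → ∀ v → Dec (P v)
regular? r v = map′ (from (correct v)) (to (correct v)) (accepts? automaton start v)
  where open Regular r

-- Closure of regular predicates under the logical connectives and quantifiers

regular-⇔ : ∀ {n} {P Q : Vec ℕ n → Set} → (∀ v → P v ⇔ Q v) → Regular P → Regular Q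
regular-⇔ eq r = record { automaton = automaton ; start = start ; correct = λ v → correct v ⇔-∘ ⇔-sym (eq v) }
  where open Regular r

regular-¬ : ∀ {n} {P : Vec ℕ n → Set} → Regular P → Regular (λ v → ¬ P v)
regular-¬ r = record
  { automaton = record
    { size = size ; Accepts = λ q v → ¬ Accepts q v ; δ = δ
    ; step = λ q bs v → mk⇔ (_∘ from (step q bs v)) (_∘ to (step q bs v))
    ; final? = λ q → ¬? (final? q) }
  ; start = start
  ; correct = λ v → mk⇔ (_∘ from (correct v)) (_∘ to (correct v)) }
  where open Regular r

regular-× : ∀ {n} {P Q : Vec ℕ n → Set} → Regular P → Regular Q → Regular (λ v → P v × Q v)
regular-× {n} {P} {Q} r s = record
  { automaton = record
    { size = R.size * S.size
    ; Accepts = Acc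
    ; δ = λ q bs → combine (R.δ (left q) bs) (S.δ (right q) bs)
    ; step = λ q bs v → combined _ _ v ⇔-∘
        mk⇔ (Prod.map (to (R.step _ bs v)) (to (S.step _ bs v)))
            (Prod.map (from (R.step _ bs v)) (from (S.step _ bs v)))
    ; final? = λ q → R.final? (left q) ×-dec S.final? (right q) }
  ; start = combine R.start S.start
  ; correct = λ v → combined _ _ v ⇔-∘
      mk⇔ (Prod.map (to (R.correct v)) (to (S.correct v)))
          (Prod.map (from (R.correct v)) (from (S.correct v))) }
  where
  module R = Regular r
  module S = Regular s
  left : Fin (R.size * S.size) → Fin R.size
  left q = proj₁ (remQuot {R.size} S.size q)
  right : Fin (R.size * S.size) → Fin S.size
  right q = proj₂ (remQuot {R.size} S.size q)
  Acc : Fin (R.size * S.size) → Vec ℕ n → Set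
  Acc q v = R.Accepts (left q) v × S.Accepts (right q) v
  combined : ∀ p q v → (R.Accepts p v × S.Accepts q v) ⇔ Acc (combine p q) v
  combined p q v = subst (λ pq → (R.Accepts p v × S.Accepts q v) ⇔ (R.Accepts (proj₁ pq) v × S.Accepts (proj₂ pq) v))
    (sym (remQuot-combine {R.size} {S.size} p q)) (⇔-id _)

module _ {n} (A : Automaton (suc n)) where
  open Automaton A

  private
    δ₀ : Bool → Fin size → Fin size
    δ₀ b q = δ q (b ∷ replicate n false)

    step₀ : ∀ q b k → Accepts q (bit b k ∷ zeros n) ⇔ Accepts (δ₀ b q) (k ∷ zeros n)
    step₀ q b k = subst (λ v → Accepts q (bit b k ∷ v) ⇔ Accepts (δ₀ b q) (k ∷ zeros n))
      (bits-zeros n) (step q (b ∷ replicate n false) (k ∷ zeros n))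

    Live : Fin size → Set
    Live q = ∃ λ k → Accepts q (k ∷ zeros n)

    Sound : Subset size → Set
    Sound S = ∀ q → q ∈ˢ S → Live q

    Closed : Subset size → Set
    Closed S = ∀ q b → δ₀ b q ∈ˢ S → q ∈ˢ S

    -- Reading the digits of `k`, with zeros on the other tracks, leads from `q` to a state that
    -- accepts all zeros. Closedness carries membership in `S` back along this run.
    complete : ∀ S → Closed S → (∀ q → Accepts q (zeros (suc n)) → q ∈ˢ S) →
               ∀ f q k → k ≤ f → Accepts q (k ∷ zeros n) → q ∈ˢ S
    complete S cl fin zero q zero z≤n acc = fin q acc
    complete S cl fin (suc f) q k k≤f acc with halve k
    ... | halved b k′ = cl q b (complete S cl fin f (δ₀ b q) k′ (bit-≤ b k′ k≤f) (to (step₀ q b k′) acc))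

    -- Backward reachability. The fuel `f` bounds the number of states still outside `S`; when it is
    -- used up, `S` contains every state.
    saturate : ∀ f S → size ≤ f + ∣ S ∣ → Sound S → (∀ q → Accepts q (zeros (suc n)) → q ∈ˢ S) →
               ∃ λ T → Sound T × (∀ q → Live q → q ∈ˢ T)
    saturate zero S big sound fin = S , sound , λ q _ →
      subst (q ∈ˢ_) (sym (∣p∣≡n⇒p≡⊤ (≤-antisym (∣p∣≤n S) big))) ∈⊤
    saturate (suc f) S big sound fin
      with any? (λ q → ¬? (q ∈? S) ×-dec ((δ₀ false q ∈? S) ⊎-dec (δ₀ true q ∈? S)))
    ... | no closed = S , sound , λ { q (k , acc) → complete S cl fin k q k ≤-refl acc }
      where
      cl : Closed S
      cl q b d∈S with q ∈? S
      cl q b     d∈S | yes q∈S = q∈S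
      cl q false d∈S | no q∉S = ⊥-elim (closed (q , q∉S , inj₁ d∈S))
      cl q true  d∈S | no q∉S = ⊥-elim (closed (q , q∉S , inj₂ d∈S))
    ... | yes (q , q∉S , d∈S) = saturate f (S ∪ ⁅ q ⁆)
        (≤-trans big (≤-trans (≤-reflexive (sym (+-suc f ∣ S ∣)))
          (+-monoʳ-≤ f (p⊂q⇒∣p∣<∣q∣ (p⊆p∪q _ , q , q⊆p∪q S _ (x∈⁅x⁆ q) , q∉S)))))
        sound′ (λ p acc → p⊆p∪q _ (fin p acc))
      where
      q-live : Live q
      q-live = [ (λ d → via false (sound _ d)) , (λ d → via true (sound _ d)) ]′ d∈S
        where
        via : ∀ b → Live (δ₀ b q) → Live q
        via b (k , acc) = bit b k , from (step₀ q b k) acc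
      sound′ : Sound (S ∪ ⁅ q ⁆)
      sound′ p p∈ with x∈p∪q⁻ S ⁅ q ⁆ p∈
      ... | inj₁ p∈S = sound p p∈S
      ... | inj₂ p∈q rewrite x∈⁅y⁆⇒x≡y q p∈q = q-live

    accepting : Subset size
    accepting = tabulate (does ∘ final?)

    live : ∃ λ T → Sound T × (∀ q → Live q → q ∈ˢ T)
    live = saturate size accepting (m≤m+n _ _) sound complete′
      where
      sound : Sound accepting
      sound q q∈ with final? q | trans (sym (lookup∘tabulate (does ∘ final?) q)) ([]=⇒lookup q∈)
      ... | yes acc | _ = 0 , acc
      complete′ : ∀ q → Accepts q (zeros (suc n)) → q ∈ˢ accepting
      complete′ q acc = lookup⇒[]= q accepting
        (trans (lookup∘tabulate (does ∘ final?) q) (Dec.dec-true (final? q) acc))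

  -- The projected number may have more digits than all the visible ones. After projection,
  -- acceptance of the zero vector is therefore a reachability question in the automaton.
  ∃-accepts? : ∀ q → Dec (∃ λ k → Accepts q (k ∷ zeros n))
  ∃-accepts? q with live
  ... | T , sound , compl = map′ (sound q) (compl q) (q ∈? T)

-- Subset construction: a state is the set of states reachable under some guess of the digits of `k`
-- read so far. Subsets are coded in `Fin (2 ^ size)` through their characteristic functions.
regular-∃ : ∀ {n} {P : Vec ℕ (suc n) → Set} → Regular P → Regular (λ v → ∃ λ k → P (k ∷ v))
regular-∃ {n} {P} r = record
  { automaton = record
    { size = 2 ^ size
    ; Accepts = Acc
    ; δ = λ S bs → set (successor? S bs)
    ; step = λ S bs v → mk⇔ (step→ S bs v) (step← S bs v)
    ; final? = λ S → any? (λ q → member? S q ×-dec ∃-accepts? automaton q) }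
  ; start = set (Fin._≟ start)
  ; correct = λ v → mk⇔
      (λ { (k , p) → start , member-set (Fin._≟ start) refl , k , to (correct _) p })
      (λ { (q , q∈ , k , acc) → k , from (correct _)
             (subst (λ q → Accepts q (k ∷ v)) (member-set⁻ (Fin._≟ start) q∈) acc) }) }
  where
  open Regular r
  member? : ∀ (S : Fin (2 ^ size)) q → Dec (finToFun {2} {size} S q ≡ suc zero)
  member? S q = finToFun {2} {size} S q Fin.≟ suc zero
  Member : Fin (2 ^ size) → Fin size → Set
  Member S q = finToFun {2} {size} S q ≡ suc zero
  Acc : Fin (2 ^ size) → Vec ℕ n → Set
  Acc S v = ∃ λ q → Member S q × ∃ λ k → Accepts q (k ∷ v)
  char : ∀ {Q : Fin size → Set} → (∀ q → Dec (Q q)) → Fin size → Fin 2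
  char Q? q = if does (Q? q) then suc zero else zero
  set : ∀ {Q : Fin size → Set} → (∀ q → Dec (Q q)) → Fin (2 ^ size)
  set Q? = funToFin {size} {2} (char Q?)
  member-set : ∀ {Q : Fin size → Set} (Q? : ∀ q → Dec (Q q)) {q} → Q q → Member (set Q?) q
  member-set Q? {q} p = trans (finToFun-funToFin {size} {2} (char Q?) q)
    (cong (if_then suc zero else zero) (Dec.dec-true (Q? q) p))
  member-set⁻ : ∀ {Q : Fin size → Set} (Q? : ∀ q → Dec (Q q)) {q} → Member (set Q?) q → Q q
  member-set⁻ Q? {q} m with Q? q | trans (sym (finToFun-funToFin {size} {2} (char Q?) q)) m
  ... | yes p | _ = p
  successor? : ∀ S bs q′ → Dec (∃ λ q → Member S q × (δ q (false ∷ bs) ≡ q′ ⊎ δ q (true ∷ bs) ≡ q′))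
  successor? S bs q′ = any? λ q →
    member? S q ×-dec ((δ q (false ∷ bs) Fin.≟ q′) ⊎-dec (δ q (true ∷ bs) Fin.≟ q′))
  step→ : ∀ S bs v → Acc S (bits bs v) → Acc (set (successor? S bs)) v
  step→ S bs v (q , q∈S , k , acc) with halve k
  ... | halved false k = _ , member-set (successor? S bs) (q , q∈S , inj₁ refl) , k , to (step q (false ∷ bs) (k ∷ v)) acc
  ... | halved true  k = _ , member-set (successor? S bs) (q , q∈S , inj₂ refl) , k , to (step q (true ∷ bs) (k ∷ v)) acc
  step← : ∀ S bs v → Acc (set (successor? S bs)) v → Acc S (bits bs v)
  step← S bs v (q′ , q′∈ , k , acc) with member-set⁻ (successor? S bs) q′∈
  ... | q , q∈S , inj₁ refl = q , q∈S , bit false k , from (step q (false ∷ bs) (k ∷ v)) acc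
  ... | q , q∈S , inj₂ refl = q , q∈S , bit true k , from (step q (true ∷ bs) (k ∷ v)) acc

-- De Morgan; the double negation can be removed constructively because regular predicates are
-- decidable. The universal quantifier is obtained from the existential one in the same way.
regular-⊎ : ∀ {n} {P Q : Vec ℕ n → Set} → Regular P → Regular Q → Regular (λ v → P v ⊎ Q v)
regular-⊎ r s = regular-⇔
  (λ v → mk⇔ (λ h → decidable-stable (regular? r v ⊎-dec regular? s v) (λ k → h (k ∘ inj₁ , k ∘ inj₂)))
             (λ { (inj₁ p) (¬p , _) → ¬p p ; (inj₂ q) (_ , ¬q) → ¬q q }))
  (regular-¬ (regular-× (regular-¬ r) (regular-¬ s)))

regular-∀ : ∀ {n} {P : Vec ℕ (suc n) → Set} → Regular P → Regular (λ v → ∀ k → P (k ∷ v))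
regular-∀ r = regular-⇔
  (λ v → mk⇔ (λ h k → decidable-stable (regular? r (k ∷ v)) (λ ¬p → h (k , ¬p))) (λ h (k , ¬p) → ¬p (h k)))
  (regular-¬ (regular-∃ (regular-¬ r)))

-- Automata for addition, terms and formulas

carry : Bool → ℕ → ℕ
carry c x = if c then suc x else x

fullAdder : ∀ c p q x y →
  carry c (bit p x + bit q y) ≡ bit ((p xor q) xor c) (carry ((p ∧ q) ∨ (c ∧ (p xor q))) (x + y))
fullAdder c p q x y = by-cases c p q
  where
  E : (x + x) + (y + y) ≡ (x + y) + (x + y)
  E = interchange +-commutativeSemigroup x x y y
  O : (x + x) + suc (y + y) ≡ suc ((x + y) + (x + y))
  O = trans (+-suc (x + x) (y + y)) (cong suc E)
  S : suc ((x + y) + (x + y)) ≡ (x + y) + suc (x + y)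
  S = sym (+-suc (x + y) (x + y))
  by-cases : ∀ c p q → carry c (bit p x + bit q y) ≡ bit ((p xor q) xor c) (carry ((p ∧ q) ∨ (c ∧ (p xor q))) (x + y))
  by-cases false false false = E
  by-cases false false true  = O
  by-cases false true  false = cong suc E
  by-cases false true  true  = cong suc (trans O S)
  by-cases true  false false = cong suc E
  by-cases true  false true  = cong suc (trans O S)
  by-cases true  true  false = cong suc (trans (cong suc E) S)
  by-cases true  true  true  = cong (λ n → suc (suc n)) (trans O S)

-- The first two states hold the pending carry; the third is the sink entered after a wrong digit.
-- The initial carry `c` is a parameter so that the same automaton also expresses successors.
regular-+ : ∀ {n} c (i j k : Fin n) → Regular (λ v → carry c (lookup v i + lookup v j) ≡ lookup v k)
regular-+ {n} c i j k = record
  { automaton = record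
    { size = 3
    ; Accepts = Acc
    ; δ = δ
    ; step = step
    ; final? = final? }
  ; start = state c
  ; correct = correct c }
  where
  Acc : Fin 3 → Vec ℕ n → Set
  Acc zero v = lookup v i + lookup v j ≡ lookup v k
  Acc (suc zero) v = suc (lookup v i + lookup v j) ≡ lookup v k
  Acc (suc (suc _)) v = ⊥
  state : Bool → Fin 3
  state false = zero
  state true = suc zero
  correct : ∀ c v → (carry c (lookup v i + lookup v j) ≡ lookup v k) ⇔ Acc (state c) v
  correct false v = ⇔-id _
  correct true  v = ⇔-id _
  next : Bool → Bool → Bool → Bool → Fin 3
  next c p q r = if does (((p xor q) xor c) Bool.≟ r) then state ((p ∧ q) ∨ (c ∧ (p xor q))) else suc (suc zero)
  δ : Fin 3 → Vec Bool n → Fin 3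
  δ zero bs = next false (lookup bs i) (lookup bs j) (lookup bs k)
  δ (suc zero) bs = next true (lookup bs i) (lookup bs j) (lookup bs k)
  δ (suc (suc q)) bs = suc (suc zero)
  next-correct : ∀ c bs v → (carry c (lookup (bits bs v) i + lookup (bits bs v) j) ≡ lookup (bits bs v) k) ⇔
    Acc (next c (lookup bs i) (lookup bs j) (lookup bs k)) v
  next-correct c bs v
    rewrite lookup-zipWith bit i bs v | lookup-zipWith bit j bs v | lookup-zipWith bit k bs v
          | fullAdder c (lookup bs i) (lookup bs j) (lookup v i) (lookup v j)
    with ((lookup bs i xor lookup bs j) xor c) Bool.≟ lookup bs k
  ... | yes eq = correct _ v ⇔-∘ mk⇔ (proj₂ ∘ bit-injective ((lookup bs i xor lookup bs j) xor c) (lookup bs k)) (cong₂ bit eq)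
  ... | no neq = mk⇔ (neq ∘ proj₁ ∘ bit-injective ((lookup bs i xor lookup bs j) xor c) (lookup bs k)) λ ()
  step : ∀ q bs v → Acc q (bits bs v) ⇔ Acc (δ q bs) v
  step zero bs v = next-correct false bs v
  step (suc zero) bs v = next-correct true bs v
  step (suc (suc zero)) bs v = ⇔-id _
  final? : ∀ q → Dec (Acc q (zeros n))
  final? zero = _ ≟ _
  final? (suc zero) = _ ≟ _
  final? (suc (suc _)) = no λ ()

at : ∀ {n} → (Var → Fin n) → Vec ℕ n → Store
at e v x = lookup v (e x)

-- Everything is expressed by addition with carry: `0` is the only solution of `a + a ≡ a`, equality
-- of two tracks is addition of `0`, and a successor is an initial carry.
regular-term : ∀ {n} t (e : Var → Fin n) (z : Fin n) → Regular (λ v → ⟦ t ⟧t (at e v) ≡ lookup v z)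
regular-term (var x) e z = regular-⇔
  (λ v → mk⇔ (λ { (a , p , q) → trans (sym (trans (cong (at e v x +_) (m+n≡m⇒n≡0 a p)) (+-identityʳ _))) q })
             (λ eq → 0 , refl , trans (+-identityʳ _) eq))
  (regular-∃ (regular-× (regular-+ false zero zero zero) (regular-+ false (suc (e x)) zero (suc z))))
  where
  m+n≡m⇒n≡0 : ∀ a → a + a ≡ a → a ≡ 0
  m+n≡m⇒n≡0 a p = +-cancelˡ-≡ a a 0 (trans p (sym (+-identityʳ a)))
regular-term (lit zero) e z = regular-⇔
  (λ v → mk⇔ (λ p → sym (+-cancelˡ-≡ (lookup v z) _ 0 (trans p (sym (+-identityʳ _))))) (λ eq → subst (λ a → a + a ≡ a) eq refl))
  (regular-+ false z z z)
regular-term (lit (suc n)) e z = regular-⇔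
  (λ v → mk⇔ (λ { (a , refl , o , p , q) →
                  trans (cong suc (sym (+-identityʳ n)))
                    (subst (λ o → suc (n + o) ≡ lookup v z) (+-cancelˡ-≡ o o 0 (trans p (sym (+-identityʳ o)))) q) })
             (λ eq → n , refl , 0 , refl , trans (cong suc (+-identityʳ n)) eq))
  (regular-∃ (regular-× (regular-term (lit n) (λ x → suc (e x)) zero)
    (regular-∃ (regular-× (regular-+ false zero zero zero) (regular-+ true (suc zero) zero (suc (suc z)))))))
regular-term (t ⊕ u) e z = regular-⇔
  (λ v → mk⇔ (λ { (a , refl , b , refl , eq) → eq }) (λ eq → _ , refl , _ , refl , eq))
  (regular-∃ (regular-× (regular-term t (λ x → suc (e x)) zero)
    (regular-∃ (regular-× (regular-term u (λ x → suc (suc (e x))) zero)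
      (regular-+ false (suc zero) zero (suc (suc z)))))))

-- Formulas depend on finitely many variables; the decision procedure

extend : ∀ {n} → (Var → Fin n) → Var → Var → Fin (suc n)
extend e x y with y ≟ x
... | yes _ = zero
... | no _  = suc (e y)

at-extend : ∀ {n} (e : Var → Fin n) x k v y → at (extend e x) (k ∷ v) y ≡ (at e v [ x ≔ k ]) y
at-extend e x k v y with y ≟ x
... | yes _ = refl
... | no _  = refl

varsᵗ : Term → ℕ
varsᵗ (var x) = suc x
varsᵗ (lit n) = 0
varsᵗ (t ⊕ u) = varsᵗ t ⊔ varsᵗ u

varsᵖ : Pure → ℕ
varsᵖ (t =ₚ u) = varsᵗ t ⊔ varsᵗ u
varsᵖ (t ≤ₚ u) = varsᵗ t ⊔ varsᵗ u
varsᵖ (¬ₚ P) = varsᵖ P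
varsᵖ (P ∧ₚ Q) = varsᵖ P ⊔ varsᵖ Q
varsᵖ (P ∨ₚ Q) = varsᵖ P ⊔ varsᵖ Q
varsᵖ (∃ₚ x P) = varsᵖ P
varsᵖ (∀ₚ x P) = varsᵖ P

_≈[_]_ : Store → ℕ → Store → Set
s ≈[ N ] s′ = ∀ x → x < N → s x ≡ s′ x

≈-left : ∀ {s s′} m n → s ≈[ m ⊔ n ] s′ → s ≈[ m ] s′
≈-left m n eq x x<m = eq x (<-≤-trans x<m (m≤m⊔n m n))

≈-right : ∀ {s s′} m n → s ≈[ m ⊔ n ] s′ → s ≈[ n ] s′
≈-right m n eq x x<n = eq x (<-≤-trans x<n (m≤n⊔m m n))

≈-sym : ∀ {s s′ N} → s ≈[ N ] s′ → s′ ≈[ N ] s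
≈-sym eq x x<N = sym (eq x x<N)

≈-update : ∀ {s s′ N} y k → s ≈[ N ] s′ → (s [ y ≔ k ]) ≈[ N ] (s′ [ y ≔ k ])
≈-update y k eq x x<N with x ≟ y
... | yes _ = refl
... | no _  = eq x x<N

⟦⟧t-cong : ∀ t {s s′} → s ≈[ varsᵗ t ] s′ → ⟦ t ⟧t s ≡ ⟦ t ⟧t s′
⟦⟧t-cong (var x) eq = eq x ≤-refl
⟦⟧t-cong (lit n) eq = refl
⟦⟧t-cong (t ⊕ u) eq = cong₂ _+_ (⟦⟧t-cong t (≈-left (varsᵗ t) (varsᵗ u) eq)) (⟦⟧t-cong u (≈-right (varsᵗ t) (varsᵗ u) eq))

⟦⟧p-cong : ∀ P {s s′} → s ≈[ varsᵖ P ] s′ → ⟦ P ⟧p s → ⟦ P ⟧p s′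
⟦⟧p-cong (t =ₚ u) eq p = trans (sym (⟦⟧t-cong t (≈-left (varsᵗ t) (varsᵗ u) eq))) (trans p (⟦⟧t-cong u (≈-right (varsᵗ t) (varsᵗ u) eq)))
⟦⟧p-cong (t ≤ₚ u) eq p = subst₂ _≤_ (⟦⟧t-cong t (≈-left (varsᵗ t) (varsᵗ u) eq)) (⟦⟧t-cong u (≈-right (varsᵗ t) (varsᵗ u) eq)) p
⟦⟧p-cong (¬ₚ P) eq ¬p p = ¬p (⟦⟧p-cong P (≈-sym eq) p)
⟦⟧p-cong (P ∧ₚ Q) eq (p , q) = ⟦⟧p-cong P (≈-left (varsᵖ P) (varsᵖ Q) eq) p , ⟦⟧p-cong Q (≈-right (varsᵖ P) (varsᵖ Q) eq) q
⟦⟧p-cong (P ∨ₚ Q) eq (inj₁ p) = inj₁ (⟦⟧p-cong P (≈-left (varsᵖ P) (varsᵖ Q) eq) p)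
⟦⟧p-cong (P ∨ₚ Q) eq (inj₂ q) = inj₂ (⟦⟧p-cong Q (≈-right (varsᵖ P) (varsᵖ Q) eq) q)
⟦⟧p-cong (∃ₚ x P) eq (k , p) = k , ⟦⟧p-cong P (≈-update x k eq) p
⟦⟧p-cong (∀ₚ x P) eq p k = ⟦⟧p-cong P (≈-update x k eq) (p k)

⟦⟧p-≗ : ∀ P {s s′} → s ≗ s′ → ⟦ P ⟧p s ⇔ ⟦ P ⟧p s′
⟦⟧p-≗ P eq = mk⇔ (⟦⟧p-cong P (λ x _ → eq x)) (⟦⟧p-cong P (λ x _ → sym (eq x)))

regular-pure : ∀ {n} P (e : Var → Fin n) → Regular (λ v → ⟦ P ⟧p (at e v))
regular-pure (t =ₚ u) e = regular-⇔
  (λ v → mk⇔ (λ { (a , p , q) → trans p (sym q) }) (λ eq → _ , eq , refl))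
  (regular-∃ (regular-× (regular-term t (λ x → suc (e x)) zero) (regular-term u (λ x → suc (e x)) zero)))
regular-pure (t ≤ₚ u) e = regular-⇔
  (λ v → mk⇔ (λ { (a , refl , b , refl , d , eq) → subst (_ ≤_) eq (m≤m+n _ d) })
             (λ le → _ , refl , _ , refl , _ , m+[n∸m]≡n le))
  (regular-∃ (regular-× (regular-term t (λ x → suc (e x)) zero)
    (regular-∃ (regular-× (regular-term u (λ x → suc (suc (e x))) zero)
      (regular-∃ (regular-+ false (suc (suc zero)) zero (suc zero)))))))
regular-pure (¬ₚ P) e = regular-¬ (regular-pure P e)
regular-pure (P ∧ₚ Q) e = regular-× (regular-pure P e) (regular-pure Q e)
regular-pure (P ∨ₚ Q) e = regular-⊎ (regular-pure P e) (regular-pure Q e)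
regular-pure (∃ₚ x P) e = regular-∃ {P = λ w → ⟦ P ⟧p (at e (tail w) [ x ≔ head w ])} (regular-⇔
  (λ { (k ∷ v) → ⟦⟧p-≗ P (at-extend e x k v) }) (regular-pure P (extend e x)))
regular-pure (∀ₚ x P) e = regular-∀ {P = λ w → ⟦ P ⟧p (at e (tail w) [ x ≔ head w ])} (regular-⇔
  (λ { (k ∷ v) → ⟦⟧p-≗ P (at-extend e x k v) }) (regular-pure P (extend e x)))

∀-regular? : ∀ n {P : Vec ℕ n → Set} → Regular P → Dec (∀ v → P v)
∀-regular? zero    r = map′ (λ { p [] → p }) (λ p → p []) (regular? r [])
∀-regular? (suc n) r = map′ (λ { p (k ∷ v) → p v k }) (λ p v k → p (k ∷ v)) (∀-regular? n (regular-∀ r))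

-- Variables beyond the bound all share track `0`. The extra track keeps the index type inhabited
-- when `N` is `0`.
index : ∀ N → Var → Fin (suc N)
index N x with x <? suc N
... | yes x<N = fromℕ< x<N
... | no _    = zero

at-index : ∀ N s x → x < suc N → at (index N) (tabulate (s ∘ toℕ)) x ≡ s x
at-index N s x x<N with x <? suc N
... | yes p = trans (lookup∘tabulate (s ∘ toℕ) (fromℕ< p)) (cong s (toℕ-fromℕ< p))
... | no ¬p = ⊥-elim (¬p x<N)

-- Pure formulas are interpreted constructively, so proving an implication that is written as
-- `¬ₚ P ∨ₚ Q` calls for a decision of `P` at the given store.
pure? : ∀ P s → Dec (⟦ P ⟧p s)
pure? P s = map′ (⟦⟧p-cong P agree) (⟦⟧p-cong P (≈-sym agree))
  (regular? (regular-pure P (index (varsᵖ P))) (tabulate (s ∘ toℕ)))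
  where
  agree : at (index (varsᵖ P)) (tabulate (s ∘ toℕ)) ≈[ varsᵖ P ] s
  agree x x<N = at-index (varsᵖ P) s x (m≤n⇒m≤1+n x<N)

presburger : ∀ P → Dec (∀ s → ⟦ P ⟧p s)
presburger P = map′
  (λ p s → ⟦⟧p-cong P (λ x x<N → at-index (varsᵖ P) s x (m≤n⇒m≤1+n x<N)) (p (tabulate (s ∘ toℕ))))
  (λ p v → p (at (index (varsᵖ P)) v))
  (∀-regular? (suc (varsᵖ P)) (regular-pure P (index (varsᵖ P))))

-- Heaps

just≢nothing : ∀ {A : Set} {m : Maybe A} {p} → m ≡ just p → m ≡ nothing → ⊥
just≢nothing refl ()

just-unique : ∀ {A : Set} {m : Maybe A} {p q} → m ≡ just p → m ≡ just q → p ≡ q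
just-unique eq eq′ = just-injective (trans (sym eq) eq′)

_⊆ʰ_ : RawHeap → RawHeap → Set
g ⊆ʰ h = ∀ {x p} → g x ≡ just p → h x ≡ just p

Disjoint : RawHeap → RawHeap → Set
Disjoint h₁ h₂ = ∀ {x p q} → h₁ x ≡ just p → h₂ x ≡ just q → ⊥

_∪ʰ_ : RawHeap → RawHeap → RawHeap
(h₁ ∪ʰ h₂) x = h₁ x <∣> h₂ x

∅ʰ : RawHeap
∅ʰ _ = nothing

∪-DisjUnion : ∀ {h₁ h₂} → Disjoint h₁ h₂ → DisjUnion (h₁ ∪ʰ h₂) h₁ h₂
∪-DisjUnion {h₁} {h₂} d x with h₁ x in e₁ | h₂ x in e₂
... | nothing | _       = inj₂ (refl , refl)
... | just _  | nothing = inj₁ (refl , refl)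
... | just _  | just _  = ⊥-elim (d e₁ e₂)

module _ {h h₁ h₂} (d : DisjUnion h h₁ h₂) where

  union-⊆ˡ : h₁ ⊆ʰ h
  union-⊆ˡ {x} eq with d x
  ... | inj₁ (e , _) = trans e eq
  ... | inj₂ (_ , e) = ⊥-elim (just≢nothing eq e)

  union-⊆ʳ : h₂ ⊆ʰ h
  union-⊆ʳ {x} eq with d x
  ... | inj₁ (_ , e) = ⊥-elim (just≢nothing eq e)
  ... | inj₂ (e , _) = trans e eq

  union-disjoint : Disjoint h₁ h₂
  union-disjoint {x} e₁ e₂ with d x
  ... | inj₁ (_ , e) = just≢nothing e₂ e
  ... | inj₂ (_ , e) = just≢nothing e₁ e

  union-split : ∀ {x p} → h x ≡ just p → h₁ x ≡ just p ⊎ h₂ x ≡ just p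
  union-split {x} eq with d x
  ... | inj₁ (e , _) = inj₁ (trans (sym e) eq)
  ... | inj₂ (e , _) = inj₂ (trans (sym e) eq)

  union-emptyˡ : EmpSem h₁ → h ≗ h₂
  union-emptyˡ emp x with d x
  ... | inj₁ (e , e′) = trans e (trans (emp x) (sym e′))
  ... | inj₂ (e , _)  = e

  union-emptyʳ : EmpSem h₂ → h ≗ h₁
  union-emptyʳ emp x with d x
  ... | inj₁ (e , _)  = e
  ... | inj₂ (e , e′) = trans e (trans (emp x) (sym e′))

⊆-Disjoint : ∀ {g₁ g₂ h₁ h₂} → g₁ ⊆ʰ h₁ → g₂ ⊆ʰ h₂ → Disjoint h₁ h₂ → Disjoint g₁ g₂
⊆-Disjoint s₁ s₂ d e₁ e₂ = d (s₁ e₁) (s₂ e₂)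

union-assocˡ : ∀ {h h₁ r h₂ h₃} → DisjUnion h h₁ r → DisjUnion r h₂ h₃ →
  DisjUnion (h₁ ∪ʰ h₂) h₁ h₂ × DisjUnion h (h₁ ∪ʰ h₂) h₃
union-assocˡ {h} {h₁} {r} {h₂} {h₃} d d′ = d₁₂ , d₁₂₃
  where
  d₁₂ : DisjUnion (h₁ ∪ʰ h₂) h₁ h₂
  d₁₂ = ∪-DisjUnion (⊆-Disjoint {h₁} {h₂} {h₁} {r} id (union-⊆ˡ d′) (union-disjoint d))
  d₁₂₃ : DisjUnion h (h₁ ∪ʰ h₂) h₃
  d₁₂₃ x with d x | d′ x | d₁₂ x
  ... | inj₁ (e , n) | inj₁ (e′ , n′) | _ rewrite e | sym e′ | n | n′ with h₁ x
  ...   | just _  = inj₁ (refl , refl)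
  ...   | nothing = inj₁ (refl , refl)
  d₁₂₃ x | inj₁ (e , n) | inj₂ (e′ , n′) | _ rewrite e | sym e′ | n | n′ with h₁ x
  ...   | just _  = inj₁ (refl , refl)
  ...   | nothing = inj₁ (refl , refl)
  d₁₂₃ x | inj₂ (e , n) | inj₁ (e′ , n′) | _ rewrite n | e | e′ = inj₁ (refl , n′)
  d₁₂₃ x | inj₂ (e , n) | inj₂ (e′ , n′) | _ rewrite n | e | e′ = inj₂ (refl , n′)

DisjUnion-comm : ∀ {h h₁ h₂} → DisjUnion h h₁ h₂ → DisjUnion h h₂ h₁
DisjUnion-comm d x with d x
... | inj₁ p = inj₂ p
... | inj₂ p = inj₁ p

union-assocʳ : ∀ {h g h₃ h₁ h₂} → DisjUnion h g h₃ → DisjUnion g h₁ h₂ →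
  DisjUnion (h₃ ∪ʰ h₂) h₂ h₃ × DisjUnion h h₁ (h₃ ∪ʰ h₂)
union-assocʳ d d′ with union-assocˡ (DisjUnion-comm d) (DisjUnion-comm d′)
... | a , b = DisjUnion-comm a , DisjUnion-comm b

DisjUnion-≗ : ∀ {h h′ h₁ h₂} → h ≗ h′ → DisjUnion h h₁ h₂ → DisjUnion h′ h₁ h₂
DisjUnion-≗ eq d x with d x
... | inj₁ (e , n) = inj₁ (trans (sym (eq x)) e , n)
... | inj₂ (e , n) = inj₂ (trans (sym (eq x)) e , n)

EmpSem-≗ : ∀ {h h′} → h ≗ h′ → EmpSem h → EmpSem h′
EmpSem-≗ eq emp x = trans (sym (eq x)) (emp x)

PtsSem-≗ : ∀ {a b c h h′} → h ≗ h′ → PtsSem a b c h → PtsSem a b c h′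
PtsSem-≗ eq (e , u) = trans (sym (eq _)) e , λ x (p , q) → u x (p , trans (eq x) q)

lsK-≗ : ∀ k {a b h h′} → h ≗ h′ → lsK k a b h → lsK k a b h′
lsK-≗ zero    eq (ff , _) = ⊥-elim (ff refl)
lsK-≗ (suc k) eq (inj₁ (e , emp)) = inj₁ (e , EmpSem-≗ eq emp)
lsK-≗ (suc k) eq (inj₂ (z , w , h₁ , h₂ , d , r)) = inj₂ (z , w , h₁ , h₂ , DisjUnion-≗ eq d , r)

dllK-≗ : ∀ k {a b c d h h′} → h ≗ h′ → dllK k a b c d h → dllK k a b c d h′
dllK-≗ zero    eq (ff , _) = ⊥-elim (ff refl)
dllK-≗ (suc k) eq (inj₁ (e , e′ , emp)) = inj₁ (e , e′ , EmpSem-≗ eq emp)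
dllK-≗ (suc k) eq (inj₂ (z , h₁ , h₂ , d , r)) = inj₂ (z , h₁ , h₂ , DisjUnion-≗ eq d , r)

⊨-≗ : ∀ {s} F {h h′} → h ≗ h′ → s , h ⊨ₛ F → s , h′ ⊨ₛ F
⊨-≗ Emp eq p = EmpSem-≗ eq p
⊨-≗ (t ↦⟨ u , v ⟩) eq p = PtsSem-≗ eq p
⊨-≗ (Arr t u) eq (le , f) = le , λ x →
  (λ (p , q) → proj₁ (f x) (p , trans (eq x) q)) , λ q → let (p , r) = proj₂ (f x) q in p , trans (sym (eq x)) r
⊨-≗ (ls t u) eq (k , p) = k , lsK-≗ k eq p
⊨-≗ (dll t u v w) eq (k , p) = k , dllK-≗ k eq p
⊨-≗ (F ✶ G) eq (h₁ , h₂ , d , p) = h₁ , h₂ , DisjUnion-≗ eq d , p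

-- Concatenation works for arbitrary end addresses because a nonempty segment may start at, or run
-- through, its own end: the two disjuncts of `lsK` do not exclude each other.
ls-append : ∀ k {a b c h h₁ h₂} → lsK k a b h₁ → (∃ λ j → lsK j b c h₂) → DisjUnion h h₁ h₂ → ∃ λ j → lsK j a c h
ls-append zero (ff , _) _ _ = ⊥-elim (ff refl)
ls-append (suc k) (inj₁ (refl , emp)) (j , q) d = j , lsK-≗ j (sym ∘ union-emptyˡ d emp) q
ls-append (suc k) (inj₂ (z , w , p , r , d′ , pts , rest)) q d =
  let d₁ , d₂ = union-assocʳ d d′
      j , res = ls-append k rest q d₁
  in suc j , inj₂ (z , w , p , _ , d₂ , pts , res)

dll-append : ∀ k {a b c d b′ c′ h h₁ h₂} → dllK k a b c d h₁ → (∃ λ j → dllK j b b′ c′ c h₂) →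
  DisjUnion h h₁ h₂ → ∃ λ j → dllK j a b′ c′ d h
dll-append zero (ff , _) _ _ = ⊥-elim (ff refl)
dll-append (suc k) (inj₁ (refl , refl , emp)) (j , q) d = j , dllK-≗ j (sym ∘ union-emptyˡ d emp) q
dll-append (suc k) (inj₂ (z , p , r , d′ , pts , rest)) q d =
  let d₁ , d₂ = union-assocʳ d d′
      j , res = dll-append k rest q d₁
  in suc j , inj₂ (z , p , _ , d₂ , pts , res)

dll⇒ls : ∀ k {a b c d h} → dllK k a b c d h → lsK k a b h
dll⇒ls zero (ff , emp) = ff , emp
dll⇒ls (suc k) (inj₁ (e , _ , emp)) = inj₁ (e , emp)
dll⇒ls (suc k) (inj₂ (z , p , r , d , pts , rest)) = inj₂ (z , _ , p , r , d , pts , dll⇒ls k rest)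

-- `dllK` peels cells off the front, whereas the canonical heap keeps the last cell of a list
-- separate, so a list must also be split from the back.
dll-unsnoc : ∀ k {a b c d z p r h} → DisjUnion h p r → PtsSem a z d p → dllK k z b c a r →
  ∃₂ λ e pre → Σ RawHeap λ last → DisjUnion h pre last × (∃ λ j → dllK j a c e d pre) × PtsSem c b e last
dll-unsnoc zero _ _ (ff , _) = ⊥-elim (ff refl)
dll-unsnoc (suc k) {d = d} {p = p} du pts (inj₁ (refl , refl , emp)) =
  d , ∅ʰ , p , (λ x → inj₂ (union-emptyʳ du emp x , refl)) , (1 , inj₁ (refl , refl , λ _ → refl)) , pts
dll-unsnoc (suc k) du pts (inj₂ (z′ , p′ , r′ , du′ , pts′ , rest))
  with dll-unsnoc k du′ pts′ rest
... | e , pre , last , du″ , (j , dl) , ptsl =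
  let d₁ , d₂ = union-assocˡ du du″
  in e , _ , last , d₂ , (suc j , inj₂ (_ , _ , pre , d₁ , pts , dl)) , ptsl

-- The subheap of h lying over G, where π sends cells of h to cells of a heap containing G.
pull : RawHeap → (ℕ → ℕ) → RawHeap → RawHeap
pull G π h y with G (π y)
... | nothing = nothing
... | just _  = h y

module _ {π : ℕ → ℕ} {h : RawHeap} where

  pull-just : ∀ {G y p q} → G (π y) ≡ just q → h y ≡ just p → pull G π h y ≡ just p
  pull-just {G} {y} e e′ with G (π y)
  pull-just refl e′ | just _ = e′

  pull-just⁻ : ∀ {G y p} → pull G π h y ≡ just p → π y ∈Dom G × h y ≡ just p
  pull-just⁻ {G} {y} e with G (π y)
  ... | just q = (q , refl) , e

  pull-nothing : ∀ {G y} → G (π y) ≡ nothing → pull G π h y ≡ nothing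
  pull-nothing {G} {y} e with G (π y)
  pull-nothing refl | nothing = refl

  pull-DisjUnion : ∀ {G G₁ G₂} → DisjUnion G G₁ G₂ → DisjUnion (pull G π h) (pull G₁ π h) (pull G₂ π h)
  pull-DisjUnion {G} {G₁} {G₂} d y with d (π y)
  ... | inj₁ (e , n) rewrite e | n = inj₁ (refl , refl)
  ... | inj₂ (e , n) rewrite e | n = inj₂ (refl , refl)

-- Passing conclusions from a canonical heap to the heap it simulates

module Simulation (B : ℕ) where

  -- H stands for h when h is replaced by a canonical heap: values below B are kept,
  -- and a cell f ≥ B of H represents all the inner cells of one list segment of h.
  record Simulates (h H : RawHeap) : Set where
    field
      π     : ℕ → ℕ
      π-dom : ∀ {y p} → h y ≡ just p → π y ∈Dom H
      π-low : ∀ {y p} → h y ≡ just p → π y < B → y ≡ π y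
      low   : ∀ {a b c} → H a ≡ just (b , c) → a < B →
              π a ≡ a × ∃₂ λ b′ c′ → h a ≡ just (b′ , c′) × (b < B → b′ ≡ b) × (c < B → c′ ≡ c)
      far-end : ∀ {f b c} → H f ≡ just (b , c) → B ≤ f → b < B
      far-ls  : ∀ {f b c a w} → H f ≡ just (b , c) → B ≤ f → H a ≡ just (f , w) → a < B →
                ∀ G → (∀ x → x ∈Dom G ⇔ (x ≡ a ⊎ x ≡ f)) → ∃ λ k → lsK k a b (pull G π h)
      far-dll : ∀ {f b a w e} → H f ≡ just (b , a) → B ≤ f → H a ≡ just (f , w) → a < B → H b ≡ just (e , f) →
                e < B × ∀ G → (∀ x → x ∈Dom G ⇔ (x ≡ a ⊎ x ≡ f ⊎ x ≡ b)) → ∃ λ k → dllK k a e b w (pull G π h)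

  Small : Store → Spatial → Set
  Small s Emp = ⊤
  Small s (t ↦⟨ u , v ⟩) = ⟦ t ⟧t s < B × ⟦ u ⟧t s < B × ⟦ v ⟧t s < B
  Small s (Arr t u) = ⟦ t ⟧t s < B × ⟦ u ⟧t s < B
  Small s (ls t u) = ⟦ t ⟧t s < B × ⟦ u ⟧t s < B
  Small s (dll t u v w) = ⟦ t ⟧t s < B × ⟦ u ⟧t s < B × ⟦ v ⟧t s < B × ⟦ w ⟧t s < B
  Small s (F ✶ G) = Small s F × Small s G

  module Transfer {h H} (sim : Simulates h H) where
    open Simulates sim

    pull′ : RawHeap → RawHeap
    pull′ G = pull G π h

    pull-Emp : ∀ {G} → EmpSem G → EmpSem (pull′ G)
    pull-Emp {G} emp y = pull-nothing {π} {h} {G} (emp (π y))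

    pull-Pts : ∀ {G a b c} → G ⊆ʰ H → a < B → PtsSem a b c G →
      ∃₂ λ b′ c′ → PtsSem a b′ c′ (pull′ G) × (b < B → b′ ≡ b) × (c < B → c′ ≡ c)
    pull-Pts {G} {a} G⊆H a<B (e , uniq) with low (G⊆H e) a<B
    ... | πa , b′ , c′ , e′ , eb , ec = b′ , c′ , (pull-just {π} {h} {G} (trans (cong G πa) e) e′ , uniq′) , eb , ec
      where
      uniq′ : ∀ x → x ∈Dom (pull′ G) → x ≡ a
      uniq′ x (p , q) with pull-just⁻ {π} {h} {G} q
      ... | g , e″ with uniq (π x) g
      ...   | refl = π-low e″ a<B

    pts-dom : ∀ {a b c G} → PtsSem a b c G → ∀ x → x ∈Dom G ⇔ x ≡ a
    pts-dom (e , u) x = mk⇔ (u x) (λ { refl → _ , e })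

    union-dom : ∀ {G G₁ G₂} {P Q : ℕ → Set} → DisjUnion G G₁ G₂ → (∀ x → x ∈Dom G₁ ⇔ P x) → (∀ x → x ∈Dom G₂ ⇔ Q x) →
      ∀ x → x ∈Dom G ⇔ (P x ⊎ Q x)
    union-dom d f g x = mk⇔
      (λ (p , e) → [ (λ e → inj₁ (to (f x) (p , e))) , (λ e → inj₂ (to (g x) (p , e))) ]′ (union-split d e))
      [ (λ q → let p , e = from (f x) q in p , union-⊆ˡ d e) , (λ q → let p , e = from (g x) q in p , union-⊆ʳ d e) ]′

    -- A cell whose successor `z` lies below `B` is copied as it is. Otherwise `z` cannot be the end
    -- `b`, so `z` is a cell of the list; `a` and `z` together are replaced by the segment from
    -- `far-ls`, and by `far-end` the list continues below `B`.
    pull-ls : ∀ k {G a b} → G ⊆ʰ H → a < B → b < B → lsK k a b G → ∃ λ j → lsK j a b (pull′ G)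
    pull-ls zero _ _ _ (ff , _) = ⊥-elim (ff refl)
    pull-ls (suc k) G⊆H _ _ (inj₁ (e , emp)) = 1 , inj₁ (e , pull-Emp emp)
    pull-ls (suc k) {G} {a} {b} G⊆H a<B b<B (inj₂ (z , w , P , R , d , pts , rest)) with z <? B
    ... | yes z<B with pull-Pts {P} (G⊆H ∘ union-⊆ˡ d) a<B pts | pull-ls k (G⊆H ∘ union-⊆ʳ d) z<B b<B rest
    ...   | b′ , c′ , pts′ , eb , _ | j , rest′ with eb z<B
    ...     | refl = suc j , inj₂ (z , c′ , _ , _ , pull-DisjUnion {π} {h} d , pts′ , rest′)
    pull-ls (suc (suc k)) {G} {a} {b} G⊆H a<B b<B (inj₂ (z , w , P , R , d , pts , inj₁ (refl , _)))
      | no z≮B = ⊥-elim (z≮B b<B)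
    pull-ls (suc zero) {G} {a} {b} G⊆H a<B b<B (inj₂ (z , w , P , R , d , pts , (ff , _)))
      | no z≮B = ⊥-elim (ff refl)
    pull-ls (suc (suc k)) {G} {a} {b} G⊆H a<B b<B (inj₂ (z , w , P , R , d , pts , inj₂ (z′ , w′ , P′ , R′ , d′ , pts′ , rest)))
      | no z≮B =
      let d₁ , d₂ = union-assocˡ d d′
          Ha = G⊆H (union-⊆ˡ d (proj₁ pts))
          Hz = G⊆H (union-⊆ʳ d (union-⊆ˡ d′ (proj₁ pts′)))
          z′<B = far-end Hz (≮⇒≥ z≮B)
          _ , seg = far-ls Hz (≮⇒≥ z≮B) Ha a<B _ (union-dom d₁ (pts-dom pts) (pts-dom pts′))
      in ls-append _ seg (pull-ls k (G⊆H ∘ union-⊆ʳ d₂) z′<B b<B rest) (pull-DisjUnion {π} {h} d₂)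

    -- A successor `z` from `B` upwards is not the end, as `b < B`, and not the last cell, as
    -- `c < B`. So the list also crosses the cell after `z`, and `far-dll` replaces all three cells
    -- at once.
    pull-dll : ∀ k {G a b c d} → G ⊆ʰ H → a < B → b < B → c < B → d < B → dllK k a b c d G →
      ∃ λ j → dllK j a b c d (pull′ G)
    pull-dll zero _ _ _ _ _ (ff , _) = ⊥-elim (ff refl)
    pull-dll (suc k) G⊆H _ _ _ _ (inj₁ (e , e′ , emp)) = 1 , inj₁ (e , e′ , pull-Emp emp)
    pull-dll (suc k) {G} G⊆H a<B b<B c<B d<B (inj₂ (z , P , R , d , pts , rest)) with z <? B
    ... | yes z<B with pull-Pts {P} (G⊆H ∘ union-⊆ˡ d) a<B pts | pull-dll k (G⊆H ∘ union-⊆ʳ d) z<B b<B c<B a<B rest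
    ...   | b′ , c′ , pts′ , eb , ec | j , rest′ with eb z<B | ec d<B
    ...     | refl | refl = suc j , inj₂ (z , _ , _ , pull-DisjUnion {π} {h} d , pts′ , rest′)
    pull-dll (suc zero) G⊆H a<B b<B c<B d<B (inj₂ (z , P , R , d , pts , (ff , _)))
      | no z≮B = ⊥-elim (ff refl)
    pull-dll (suc (suc k)) G⊆H a<B b<B c<B d<B (inj₂ (z , P , R , d , pts , inj₁ (refl , _)))
      | no z≮B = ⊥-elim (z≮B b<B)
    pull-dll (suc (suc zero)) G⊆H a<B b<B c<B d<B (inj₂ (z , P , R , d , pts , inj₂ (z′ , P′ , R′ , d′ , pts′ , (ff , _))))
      | no z≮B = ⊥-elim (ff refl)
    pull-dll (suc (suc (suc k))) G⊆H a<B b<B c<B d<B (inj₂ (z , P , R , d , pts , inj₂ (z′ , P′ , R′ , d′ , pts′ , inj₁ (_ , refl , _))))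
      | no z≮B = ⊥-elim (z≮B c<B)
    pull-dll (suc (suc (suc k))) G⊆H a<B b<B c<B d<B
      (inj₂ (z , P , R , d , pts , inj₂ (z′ , P′ , R′ , d′ , pts′ , inj₂ (z″ , P″ , R″ , d″ , pts″ , rest))))
      | no z≮B =
      let d₁ , d₂ = union-assocˡ d′ d″
          d₃ , d₄ = union-assocˡ d d₂
          Ha = G⊆H (union-⊆ˡ d (proj₁ pts))
          Hz = G⊆H (union-⊆ʳ d (union-⊆ˡ d′ (proj₁ pts′)))
          Hv = G⊆H (union-⊆ʳ d (union-⊆ʳ d′ (union-⊆ˡ d″ (proj₁ pts″))))
          z′<B = far-end Hz (≮⇒≥ z≮B)
          z″<B , segs = far-dll Hz (≮⇒≥ z≮B) Ha a<B Hv
          _ , seg = segs _ (union-dom d₃ (pts-dom pts) (union-dom d₁ (pts-dom pts′) (pts-dom pts″)))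
      in dll-append _ seg (pull-dll k (G⊆H ∘ union-⊆ʳ d₄) z″<B b<B c<B z′<B rest) (pull-DisjUnion {π} {h} d₄)

    transfer : ∀ {s} F {G} → Small s F → G ⊆ʰ H → s , G ⊨ₛ F → s , pull′ G ⊨ₛ F
    transfer Emp _ _ emp = pull-Emp emp
    -- Both contents are values of small terms, hence below `B`; they are no junk, and `h` stores
    -- the same pair.
    transfer (t ↦⟨ u , v ⟩) {G} (t<B , u<B , v<B) G⊆H pts with pull-Pts {G} G⊆H t<B pts
    ... | b′ , c′ , pts′ , eb , ec rewrite eb u<B | ec v<B = pts′
    transfer (Arr t u) {G} (t<B , u<B) G⊆H (t≤u , f) = t≤u , λ x → out x , into x
      where
      out : ∀ x → x ∈Dom (pull′ G) → _ × _
      out x (p , q) with pull-just⁻ {π} {h} {G} q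
      ... | g , e with proj₁ (f (π x)) g
      ...   | l , r = subst (λ x → _ ≤ x × x ≤ _) (sym (π-low e (≤-<-trans r u<B))) (l , r)
      into : ∀ x → _ × _ → x ∈Dom (pull′ G)
      into x (l , r) with proj₂ (f x) (l , r)
      ... | p , q with low (G⊆H q) (≤-<-trans r u<B)
      ...   | πx , _ , _ , e , _ = _ , pull-just {π} {h} {G} (trans (cong G πx) q) e
    transfer (ls t u) (t<B , u<B) G⊆H (k , p) = pull-ls k G⊆H t<B u<B p
    transfer (dll t u v w) (t<B , u<B , v<B , w<B) G⊆H (k , p) = pull-dll k G⊆H t<B u<B v<B w<B p
    transfer (F ✶ F′) (sF , sF′) G⊆H (G₁ , G₂ , d , p , q) =
      _ , _ , pull-DisjUnion {π} {h} d , transfer F sF (G⊆H ∘ union-⊆ˡ d) p , transfer F′ sF′ (G⊆H ∘ union-⊆ʳ d) q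

    transfer-whole : ∀ {s} F → Small s F → s , H ⊨ₛ F → s , h ⊨ₛ F
    transfer-whole F sF p = ⊨-≗ F pull-whole (transfer F sF id p)
      where
      pull-whole : pull′ H ≗ h
      pull-whole y with h y in e
      ... | just p = let _ , q = π-dom e in pull-just {π} {h} {H} q e
      ... | nothing with H (π y)
      ...   | just _ = e
      ...   | nothing = refl

-- Canonical heaps

-- A finite union of closed intervals with terms as end points: enough to describe the domain of a
-- canonical heap inside Presburger arithmetic.
Region : Set
Region = List (Term × Term)

InRegion : Store → Region → ℕ → Set
InRegion s r x = Any (λ (t , u) → ⟦ t ⟧t s ≤ x × x ≤ ⟦ u ⟧t s) r

⊤ₚ ⊥ₚ : Pure
⊤ₚ = lit 0 =ₚ lit 0
⊥ₚ = lit 0 =ₚ lit 1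

memₚ : Var → Region → Pure
memₚ x [] = ⊥ₚ
memₚ x ((t , u) ∷ r) = ((t ≤ₚ var x) ∧ₚ (var x ≤ₚ u)) ∨ₚ memₚ x r

fresh : Region → Var
fresh [] = 0
fresh ((t , u) ∷ r) = (varsᵗ t ⊔ varsᵗ u) ⊔ fresh r

update-same : ∀ s x n → (s [ x ≔ n ]) x ≡ n
update-same s x n with x ≟ x
... | yes _ = refl
... | no x≢x = ⊥-elim (x≢x refl)

update-below : ∀ s {N} x n → N ≤ x → s ≈[ N ] (s [ x ≔ n ])
update-below s x n N≤x y y<N with y ≟ x
... | yes refl = ⊥-elim (<⇒≱ y<N N≤x)
... | no _ = refl

⟦memₚ⟧ : ∀ s x n r → fresh r ≤ x → ⟦ memₚ x r ⟧p (s [ x ≔ n ]) ⇔ InRegion s r n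
⟦memₚ⟧ s x n [] _ = mk⇔ (λ ()) (λ ())
⟦memₚ⟧ s x n ((t , u) ∷ r) fr = mk⇔
  (λ { (inj₁ (p , q)) → here (subst₂ _≤_ (sym eqt) (update-same s x n) p , subst₂ _≤_ (update-same s x n) (sym equ) q)
     ; (inj₂ p) → there (to rec p) })
  (λ { (here (p , q)) → inj₁ (subst₂ _≤_ eqt (sym (update-same s x n)) p , subst₂ _≤_ (sym (update-same s x n)) equ q)
     ; (there p) → inj₂ (from rec p) })
  where
  m≤ = ≤-trans (m≤m⊔n (varsᵗ t ⊔ varsᵗ u) (fresh r)) fr
  eqt = ⟦⟧t-cong t (update-below s x n (≤-trans (m≤m⊔n (varsᵗ t) (varsᵗ u)) m≤))
  equ = ⟦⟧t-cong u (update-below s x n (≤-trans (m≤n⊔m (varsᵗ t) (varsᵗ u)) m≤))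
  rec = ⟦memₚ⟧ s x n r (≤-trans (m≤n⊔m (varsᵗ t ⊔ varsᵗ u) (fresh r)) fr)

disjointₚ : Region → Region → Pure
disjointₚ r r′ = ∀ₚ x (¬ₚ (memₚ x r ∧ₚ memₚ x r′))
  where x = fresh r ⊔ fresh r′

-- Equivalence is spelled out as "both or neither", so deriving it from an equality of sets uses
-- that `InRegion` is decidable.
sameₚ : Region → Region → Pure
sameₚ r r′ = ∀ₚ x ((memₚ x r ∧ₚ memₚ x r′) ∨ₚ ((¬ₚ memₚ x r) ∧ₚ (¬ₚ memₚ x r′)))
  where x = fresh r ⊔ fresh r′

⟦disjointₚ⟧ : ∀ s r r′ → ⟦ disjointₚ r r′ ⟧p s ⇔ (∀ x → InRegion s r x → InRegion s r′ x → ⊥)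
⟦disjointₚ⟧ s r r′ = mk⇔
  (λ f n p q → f n (from (⟦memₚ⟧ s _ n r (m≤m⊔n _ _)) p , from (⟦memₚ⟧ s _ n r′ (m≤n⊔m (fresh r) _)) q))
  (λ f n (p , q) → f n (to (⟦memₚ⟧ s _ n r (m≤m⊔n _ _)) p) (to (⟦memₚ⟧ s _ n r′ (m≤n⊔m (fresh r) _)) q))

inRegion? : ∀ s r x → Dec (InRegion s r x)
inRegion? s r x = Any.any? (λ (t , u) → (⟦ t ⟧t s ≤? x) ×-dec (x ≤? ⟦ u ⟧t s)) r

⟦sameₚ⟧ : ∀ s r r′ → ⟦ sameₚ r r′ ⟧p s ⇔ (∀ x → InRegion s r x ⇔ InRegion s r′ x)
⟦sameₚ⟧ s r r′ = mk⇔ (λ f n → forth n (f n)) (λ f n → back n (f n))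
  where
  M = λ n → ⟦memₚ⟧ s (fresh r ⊔ fresh r′) n r (m≤m⊔n _ _)
  M′ = λ n → ⟦memₚ⟧ s (fresh r ⊔ fresh r′) n r′ (m≤n⊔m (fresh r) _)
  forth : ∀ n → _ → InRegion s r n ⇔ InRegion s r′ n
  forth n (inj₁ (p , q)) = mk⇔ (λ _ → to (M′ n) q) (λ _ → to (M n) p)
  forth n (inj₂ (p , q)) = mk⇔ (λ i → ⊥-elim (p (from (M n) i))) (λ i → ⊥-elim (q (from (M′ n) i)))
  back : ∀ n → InRegion s r n ⇔ InRegion s r′ n → _
  back n e with inRegion? s r n
  ... | yes p = inj₁ (from (M n) p , from (M′ n) (to e p))
  ... | no ¬p = inj₂ (¬p ∘ to (M n) , ¬p ∘ from e ∘ to (M′ n))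

region : Spatial → Region
region Emp = []
region (t ↦⟨ u , v ⟩) = (t , t) ∷ []
region (Arr t u) = (t , u) ∷ []
region (ls t u) = []
region (dll t u v w) = []
region (F ✶ G) = region F ++ region G

-- The list predicates are ill-formed: they only occur before unfolding.
wfₚ : Spatial → Pure
wfₚ Emp = ⊤ₚ
wfₚ (t ↦⟨ u , v ⟩) = ⊤ₚ
wfₚ (Arr t u) = t ≤ₚ u
wfₚ (ls t u) = ⊥ₚ
wfₚ (dll t u v w) = ⊥ₚ
wfₚ (F ✶ G) = (wfₚ F ∧ₚ wfₚ G) ∧ₚ disjointₚ (region F) (region G)

Cell : Set
Cell = Term × Term × Term

cells : Spatial → List Cell
cells (t ↦⟨ u , v ⟩) = (t , u , v) ∷ []
cells (F ✶ G) = cells F ++ cells G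
cells _ = []

-- Array cells of the canonical heap all hold (J , J).
module Reading (s : Store) (J : ℕ) where

  infix 9 ⟦_⟧
  ⟦_⟧ : Term → ℕ
  ⟦ t ⟧ = ⟦ t ⟧t s

  read : Spatial → RawHeap
  read Emp x = nothing
  read (t ↦⟨ u , v ⟩) x with x ≟ ⟦ t ⟧
  ... | yes _ = just (⟦ u ⟧ , ⟦ v ⟧)
  ... | no _  = nothing
  read (Arr t u) x with (⟦ t ⟧ ≤? x) ×-dec (x ≤? ⟦ u ⟧)
  ... | yes _ = just (J , J)
  ... | no _  = nothing
  read (ls t u) x = nothing
  read (dll t u v w) x = nothing
  -- On an overlap the left operand wins; `wfₚ` excludes overlaps.
  read (F ✶ G) = read F ∪ʰ read G

  read-cell : ∀ t u v → PtsSem ⟦ t ⟧ ⟦ u ⟧ ⟦ v ⟧ (read (t ↦⟨ u , v ⟩))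
  read-cell t u v = at-t , uniq
    where
    at-t : read (t ↦⟨ u , v ⟩) ⟦ t ⟧ ≡ just (⟦ u ⟧ , ⟦ v ⟧)
    at-t with ⟦ t ⟧ ≟ ⟦ t ⟧
    ... | yes _ = refl
    ... | no ≢  = ⊥-elim (≢ refl)
    uniq : ∀ x → x ∈Dom read (t ↦⟨ u , v ⟩) → x ≡ ⟦ t ⟧
    uniq x (p , q) with x ≟ ⟦ t ⟧
    ... | yes eq = eq

  read-cell⁻ : ∀ t u v {x p} → read (t ↦⟨ u , v ⟩) x ≡ just p → x ≡ ⟦ t ⟧ × p ≡ (⟦ u ⟧ , ⟦ v ⟧)
  read-cell⁻ t u v {x} q with x ≟ ⟦ t ⟧
  read-cell⁻ t u v refl | yes eq = eq , refl

  read-arr : ∀ t u {x} → ⟦ t ⟧ ≤ x → x ≤ ⟦ u ⟧ → read (Arr t u) x ≡ just (J , J)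
  read-arr t u {x} l r with (⟦ t ⟧ ≤? x) ×-dec (x ≤? ⟦ u ⟧)
  ... | yes _ = refl
  ... | no ¬p = ⊥-elim (¬p (l , r))

  read-arr⁻ : ∀ t u {x p} → read (Arr t u) x ≡ just p → (⟦ t ⟧ ≤ x × x ≤ ⟦ u ⟧) × p ≡ (J , J)
  read-arr⁻ t u {x} q with (⟦ t ⟧ ≤? x) ×-dec (x ≤? ⟦ u ⟧)
  read-arr⁻ t u refl | yes p = p , refl

  ∪-split : ∀ {h₁ h₂ x p} → (h₁ ∪ʰ h₂) x ≡ just p → h₁ x ≡ just p ⊎ h₂ x ≡ just p
  ∪-split {h₁} {h₂} {x} e with h₁ x
  ... | just _  = inj₁ e
  ... | nothing = inj₂ e

  read-region : ∀ F x → x ∈Dom read F → InRegion s (region F) x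
  read-region (t ↦⟨ u , v ⟩) x (_ , q) with read-cell⁻ t u v q
  ... | refl , _ = here (≤-refl , ≤-refl)
  read-region (Arr t u) x (_ , q) = here (proj₁ (read-arr⁻ t u q))
  read-region (F ✶ G) x (p , q) with ∪-split {read F} {read G} q
  ... | inj₁ q = ++⁺ˡ (read-region F x (p , q))
  ... | inj₂ q = ++⁺ʳ (region F) (read-region G x (p , q))

  region-read : ∀ F x → InRegion s (region F) x → x ∈Dom read F
  region-read (t ↦⟨ u , v ⟩) x (here (p , q)) with ≤-antisym p q
  ... | refl = _ , proj₁ (read-cell t u v)
  region-read (Arr t u) x (here (p , q)) = _ , read-arr t u p q
  region-read (F ✶ G) x i with ++⁻ (region F) i
  region-read (F ✶ G) x i | inj₁ j with region-read F x j
  ...   | p , q rewrite q = _ , refl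
  region-read (F ✶ G) x i | inj₂ j with read F x
  ...   | just p  = p , refl
  ...   | nothing = region-read G x j

  ⟦region⟧ : ∀ F x → x ∈Dom read F ⇔ InRegion s (region F) x
  ⟦region⟧ F x = mk⇔ (read-region F x) (region-read F x)

  wf-disjoint : ∀ F G → ⟦ wfₚ (F ✶ G) ⟧p s → Disjoint (read F) (read G)
  wf-disjoint F G (_ , d) p q =
    to (⟦disjointₚ⟧ s (region F) (region G)) d _ (read-region F _ (_ , p)) (read-region G _ (_ , q))

  disjoint-wf : ∀ F G → ⟦ wfₚ F ⟧p s → ⟦ wfₚ G ⟧p s → Disjoint (read F) (read G) → ⟦ wfₚ (F ✶ G) ⟧p s
  disjoint-wf F G p q d = (p , q) , from (⟦disjointₚ⟧ s (region F) (region G))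
    (λ x i j → d (proj₂ (region-read F x i)) (proj₂ (region-read G x j)))

  read-sat : ∀ F → ⟦ wfₚ F ⟧p s → s , read F ⊨ₛ F
  read-sat Emp _ x = refl
  read-sat (t ↦⟨ u , v ⟩) _ = read-cell t u v
  read-sat (Arr t u) t≤u = t≤u , λ x → (λ (_ , q) → proj₁ (read-arr⁻ t u q)) , λ (p , q) → _ , read-arr t u p q
  read-sat (F ✶ G) wf@((p , q) , _) =
    read F , read G , ∪-DisjUnion (wf-disjoint F G wf) , read-sat F p , read-sat G q

  read-finite : ∀ F → ∃ λ b → ∀ x → b ≤ x → read F x ≡ nothing
  read-finite Emp = 0 , λ _ _ → refl
  read-finite (t ↦⟨ u , v ⟩) = suc ⟦ t ⟧ , λ x le → out x le
    where
    out : ∀ x → suc ⟦ t ⟧ ≤ x → read (t ↦⟨ u , v ⟩) x ≡ nothing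
    out x le with x ≟ ⟦ t ⟧
    ... | yes refl = ⊥-elim (<-irrefl refl le)
    ... | no _ = refl
  read-finite (Arr t u) = suc ⟦ u ⟧ , λ x le → out x le
    where
    out : ∀ x → suc ⟦ u ⟧ ≤ x → read (Arr t u) x ≡ nothing
    out x le with (⟦ t ⟧ ≤? x) ×-dec (x ≤? ⟦ u ⟧)
    ... | yes (_ , r) = ⊥-elim (<⇒≱ le r)
    ... | no _ = refl
  read-finite (ls t u) = 0 , λ _ _ → refl
  read-finite (dll t u v w) = 0 , λ _ _ → refl
  read-finite (F ✶ G) with read-finite F | read-finite G
  ... | b , f | c , g = b ⊔ c , λ x le → out x (f x (≤-trans (m≤m⊔n b c) le)) (g x (≤-trans (m≤n⊔m b c) le))
    where
    out : ∀ x → read F x ≡ nothing → read G x ≡ nothing → (read F ∪ʰ read G) x ≡ nothing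
    out x e e′ rewrite e = e′

  Stores : RawHeap → Cell → Set
  Stores h (t , u , v) = h ⟦ t ⟧ ≡ just (⟦ u ⟧ , ⟦ v ⟧)

  -- The disjointness contained in `wfₚ` prevents a cell of the right operand from being shadowed by
  -- the left one.
  read-cells : ∀ F → ⟦ wfₚ F ⟧p s → ∀ c → c ∈ cells F → Stores (read F) c
  read-cells (t ↦⟨ u , v ⟩) _ _ (here refl) = proj₁ (read-cell t u v)
  read-cells (F ✶ G) wf@((p , q) , _) c@(t , _) c∈ with ++⁻ (cells F) c∈
  ... | inj₁ c∈ = union-⊆ˡ {h₁ = read F} {read G} (∪-DisjUnion (wf-disjoint F G wf)) {⟦ t ⟧} (read-cells F p c c∈)
  ... | inj₂ c∈ = union-⊆ʳ {h₁ = read F} {read G} (∪-DisjUnion (wf-disjoint F G wf)) {⟦ t ⟧} (read-cells G q c c∈)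

  Denotes : ℕ → ℕ → ℕ → Cell → Set
  Denotes a b c (t , u , v) = a ≡ ⟦ t ⟧ × b ≡ ⟦ u ⟧ × c ≡ ⟦ v ⟧

  -- A first field other than `J` rules out array cells, and every other cell is listed in `cells`.
  read-denoted : ∀ F {a b c} → read F a ≡ just (b , c) → b ≢ J → Any (Denotes a b c) (cells F)
  read-denoted (t ↦⟨ u , v ⟩) q _ with read-cell⁻ t u v q
  ... | refl , refl = here (refl , refl , refl)
  read-denoted (Arr t u) q b≢J with read-arr⁻ t u q
  ... | _ , refl = ⊥-elim (b≢J refl)
  read-denoted (F ✶ G) q b≢J with ∪-split {read F} {read G} q
  ... | inj₁ q = ++⁺ˡ (read-denoted F q b≢J)
  ... | inj₂ q = ++⁺ʳ (cells F) (read-denoted G q b≢J)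

-- Bounded unfoldings of the list predicates

module Unfolding (Bₜ : Term) where

  -- The choice is a number of cells, its largest value standing for all longer lists: "at least
  -- two" for `ls`, "at least three" for `dll`.
  Choice : Spatial → Set
  Choice (ls t u) = Fin 3
  Choice (dll t u v w) = Fin 4
  Choice (F ✶ G) = Choice F × Choice G
  Choice _ = ⊤

  atoms : Spatial → ℕ
  atoms (F ✶ G) = atoms F + atoms G
  atoms _ = 1

  -- The offset `suc i` keeps every far address different from the junk value itself.
  farₜ : ℕ → Term
  farₜ i = Bₜ ⊕ lit (suc i)

  -- i counts the atoms to the left, so that distinct segments get distinct far addresses.
  unfold : ℕ → ∀ F → Choice F → Spatial
  unfold i (ls t u) zero = Emp
  unfold i (ls t u) (suc zero) = t ↦⟨ u , Bₜ ⟩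
  unfold i (ls t u) (suc (suc _)) = (t ↦⟨ farₜ i , Bₜ ⟩) ✶ (farₜ i ↦⟨ u , Bₜ ⟩)
  unfold i (dll t u v w) zero = Emp
  unfold i (dll t u v w) (suc zero) = t ↦⟨ u , w ⟩
  unfold i (dll t u v w) (suc (suc zero)) = (t ↦⟨ v , w ⟩) ✶ (v ↦⟨ u , t ⟩)
  unfold i (dll t u v w) (suc (suc (suc _))) = (t ↦⟨ farₜ i , w ⟩) ✶ ((farₜ i ↦⟨ v , t ⟩) ✶ (v ↦⟨ u , farₜ i ⟩))
  unfold i (F ✶ G) (c , d) = unfold i F c ✶ unfold (i + atoms F) G d
  unfold i Emp c = Emp
  unfold i (t ↦⟨ u , v ⟩) c = t ↦⟨ u , v ⟩
  unfold i (Arr t u) c = Arr t u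

  condₚ : ∀ F → Choice F → Pure
  condₚ (ls t u) zero = t =ₚ u
  condₚ (dll t u v w) zero = (t =ₚ u) ∧ₚ (v =ₚ w)
  -- In a list of one cell, the first cell `t` is also the last cell `v`.
  condₚ (dll t u v w) (suc zero) = t =ₚ v
  condₚ (F ✶ G) (c , d) = condₚ F c ∧ₚ condₚ G d
  condₚ _ _ = ⊤ₚ

  -- This makes a canonical heap a model of the antecedent, so that validity can be applied to it.
  unfold-sound : ∀ {s h} i F c → ⟦ condₚ F c ⟧p s → s , h ⊨ₛ unfold i F c → s , h ⊨ₛ F
  unfold-sound i Emp c _ p = p
  unfold-sound i (t ↦⟨ u , v ⟩) c _ p = p
  unfold-sound i (Arr t u) c _ p = p
  unfold-sound i (ls t u) zero e p = 1 , inj₁ (e , p)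
  unfold-sound i (ls t u) (suc zero) _ p =
    2 , inj₂ (_ , _ , _ , ∅ʰ , (λ x → inj₁ (refl , refl)) , p , inj₁ (refl , λ _ → refl))
  unfold-sound i (ls t u) (suc (suc _)) _ (h₁ , h₂ , d , p , q) =
    3 , inj₂ (_ , _ , h₁ , h₂ , d , p ,
      inj₂ (_ , _ , h₂ , ∅ʰ , (λ x → inj₁ (refl , refl)) , q , inj₁ (refl , λ _ → refl)))
  unfold-sound i (dll t u v w) zero (e , e′) p = 1 , inj₁ (e , e′ , p)
  unfold-sound i (dll t u v w) (suc zero) e p =
    2 , inj₂ (_ , _ , ∅ʰ , (λ x → inj₁ (refl , refl)) , p , inj₁ (refl , sym e , λ _ → refl))
  unfold-sound i (dll t u v w) (suc (suc zero)) _ (h₁ , h₂ , d , p , q) =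
    3 , inj₂ (_ , h₁ , h₂ , d , p ,
      inj₂ (_ , h₂ , ∅ʰ , (λ x → inj₁ (refl , refl)) , q , inj₁ (refl , refl , λ _ → refl)))
  unfold-sound i (dll t u v w) (suc (suc (suc _))) _ (h₁ , h₂ , d , p , h₃ , h₄ , d′ , q , r) =
    4 , inj₂ (_ , h₁ , h₂ , d , p , inj₂ (_ , h₃ , h₄ , d′ , q ,
      inj₂ (_ , h₄ , ∅ʰ , (λ x → inj₁ (refl , refl)) , r , inj₁ (refl , refl , λ _ → refl))))
  unfold-sound i (F ✶ G) (c , d) (p , q) (h₁ , h₂ , du , r , r′) =
    h₁ , h₂ , du , unfold-sound i F c p r , unfold-sound (i + atoms F) G d q r′

pts⁻ : ∀ {a b c h x p} → PtsSem a b c h → h x ≡ just p → x ≡ a × p ≡ (b , c)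
pts⁻ (e , u) q with u _ (_ , q)
... | refl = refl , just-unique q e

-- Constructing simulations

module Simulating (B : ℕ) where
  open Simulation B
  open Simulates

  -- x is one of the far addresses numbered i, …, j − 1.
  Own : ℕ → ℕ → ℕ → Set
  Own i j x = B + i < x × x ≤ B + j

  Own-≮ : ∀ {i j x} → Own i j x → x ≤ B → ⊥
  Own-≮ {i} (l , _) le = <⇒≱ (≤-<-trans (m≤m+n B i) l) le

  Own-disjoint : ∀ {i j k x} → Own i j x → Own j k x → ⊥
  Own-disjoint (_ , u) (l , _) = <⇒≱ l u

  Own-weaken : ∀ {i i′ j j′ x} → i′ ≤ i → j ≤ j′ → Own i j x → Own i′ j′ x
  Own-weaken p q (l , u) = ≤-<-trans (+-monoʳ-≤ B p) l , ≤-trans u (+-monoʳ-≤ B q)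

  -- The invariant that keeps separate parts of a canonical heap independent: `B` is never an
  -- address, and a far address is allocated or pointed to only inside the part that owns it.
  record Ranged (i j : ℕ) (H : RawHeap) : Set where
    field
      addresses : ∀ {a p} → H a ≡ just p → a < B ⊎ Own i j a
      contents  : ∀ {a b c} → H a ≡ just (b , c) → (b ≤ B ⊎ Own i j b) × (c ≤ B ⊎ Own i j c)
  open Ranged

  Ranged-pts : ∀ {i j a b c H} → PtsSem a b c H → a < B ⊎ Own i j a → b ≤ B ⊎ Own i j b → c ≤ B ⊎ Own i j c → Ranged i j H
  Ranged-pts pts ra rb rc .addresses e with pts⁻ pts e
  ... | refl , _ = ra
  Ranged-pts pts ra rb rc .contents e with pts⁻ pts e
  ... | _ , refl = rb , rc

  Ranged-∪ : ∀ {i j H₁ H₂} → Ranged i j H₁ → Ranged i j H₂ → Ranged i j (H₁ ∪ʰ H₂)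
  Ranged-∪ {H₁ = H₁} r₁ r₂ .addresses {a} e with H₁ a in eq
  ... | just _  = addresses r₁ eq
  ... | nothing = addresses r₂ e
  Ranged-∪ {H₁ = H₁} r₁ r₂ .contents {a} e with H₁ a in eq
  ... | just _  = contents r₁ (trans eq e)
  ... | nothing = contents r₂ e

  Ranged-∅ : ∀ {i j} → Ranged i j ∅ʰ
  Ranged-∅ .addresses ()
  Ranged-∅ .contents ()

  Ranged-weaken : ∀ {i i′ j j′ H} → i′ ≤ i → j ≤ j′ → Ranged i j H → Ranged i′ j′ H
  Ranged-weaken p q r .addresses e = Sum.map₂ (Own-weaken p q) (addresses r e)
  Ranged-weaken p q r .contents e =
    Prod.map (Sum.map₂ (Own-weaken p q)) (Sum.map₂ (Own-weaken p q)) (contents r e)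

  -- Without far cells, the identity serves as `π` and the far clauses hold vacuously.
  Simulates-exact : ∀ {h H} → (∀ {x p} → h x ≡ just p → x ∈Dom H) → (∀ {a p} → H a ≡ just p → a < B) →
    (∀ {a b c} → H a ≡ just (b , c) → ∃₂ λ b′ c′ → h a ≡ just (b′ , c′) × (b < B → b′ ≡ b) × (c < B → c′ ≡ c)) →
    Simulates h H
  Simulates-exact dom small cont .π = id
  Simulates-exact dom small cont .π-dom = dom
  Simulates-exact dom small cont .π-low _ _ = refl
  Simulates-exact dom small cont .low e _ = refl , cont e
  Simulates-exact dom small cont .far-end e le = ⊥-elim (<⇒≱ (small e) le)
  Simulates-exact dom small cont .far-ls e le = ⊥-elim (<⇒≱ (small e) le)
  Simulates-exact dom small cont .far-dll e le = ⊥-elim (<⇒≱ (small e) le)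

  -- A common address below `B` would be allocated in both `h₁` and `h₂`; far addresses come from
  -- adjacent, disjoint ranges.
  Simulates-disjoint : ∀ {i j k h₁ h₂ H₁ H₂} → Ranged i j H₁ → Ranged j k H₂ →
    Simulates h₁ H₁ → Simulates h₂ H₂ → Disjoint h₁ h₂ → Disjoint H₁ H₂
  Simulates-disjoint r₁ r₂ s₁ s₂ d e₁ e₂ with addresses r₁ e₁ | addresses r₂ e₂
  ... | inj₁ x<B | _ =
    let _ , _ , _ , p , _ = low s₁ e₁ x<B
        _ , _ , _ , q , _ = low s₂ e₂ x<B
    in d p q
  ... | inj₂ o | inj₁ x<B = Own-≮ o (<⇒≤ x<B)
  ... | inj₂ o | inj₂ o′ = Own-disjoint o o′

  -- A stored pointer from `B` upwards is either `B`, which is never allocated, or a far address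
  -- owned by the heap that stores it, which is not allocated in a heap with other far addresses.
  foreign : ∀ {i j x} → x ≤ B ⊎ Own i j x → B ≤ x → ∀ {m n H p} → Ranged m n H → H x ≡ just p →
    (∀ {y} → Own i j y → Own m n y → ⊥) → ⊥
  foreign (inj₁ x≤B) le r e apart with addresses r e
  ... | inj₁ x<B = <⇒≱ x<B le
  ... | inj₂ o   = Own-≮ o x≤B
  foreign (inj₂ o) le r e apart with addresses r e
  ... | inj₁ x<B = <⇒≱ x<B le
  ... | inj₂ o′  = apart o o′

  module _ {i j k h h₁ h₂ H H₁ H₂} (d : DisjUnion h h₁ h₂) (D : DisjUnion H H₁ H₂)
           (r₁ : Ranged i j H₁) (r₂ : Ranged j k H₂) (s₁ : Simulates h₁ H₁) (s₂ : Simulates h₂ H₂) where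

    private
      π∪ : ℕ → ℕ
      π∪ y with h₁ y
      ... | just _  = π s₁ y
      ... | nothing = π s₂ y

      π∪-left : ∀ {y p} → h₁ y ≡ just p → π∪ y ≡ π s₁ y
      π∪-left {y} e with h₁ y
      ... | just _ = refl

      π∪-right : ∀ {y p} → h₂ y ≡ just p → π∪ y ≡ π s₂ y
      π∪-right {y} e with h₁ y in e₁
      ... | just _  = ⊥-elim (union-disjoint d e₁ e)
      ... | nothing = refl

      -- Cells that belong to `h₂` are sent into `H₂`, where `G` is undefined, so they do not enter
      -- the pullback.
      pull-left : ∀ G → (∀ {x} → x ∈Dom G → x ∈Dom H₁) → pull G (π s₁) h₁ ≗ pull G π∪ h
      pull-left G sub y with h₁ y in e₁ | h y in e
      ... | just p | nothing = ⊥-elim (just≢nothing (union-⊆ˡ d e₁) e)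
      ... | just p | just q with trans (sym e) (union-⊆ˡ d e₁)
      ...   | refl with G (π s₁ y)
      ...     | just _  = trans e₁ (sym e)
      ...     | nothing = refl
      pull-left G sub y | nothing | nothing with G (π s₁ y) | G (π s₂ y)
      ... | just _  | just _ = trans e₁ (sym e)
      ... | just _  | nothing = e₁
      ... | nothing | just _ = sym e
      ... | nothing | nothing = refl
      pull-left G sub y | nothing | just p with union-split d e
      ... | inj₁ e′ = ⊥-elim (just≢nothing e′ e₁)
      ... | inj₂ e′ with G (π s₂ y) in g
      ...   | just _ = ⊥-elim (union-disjoint D (proj₂ (sub (_ , g))) (proj₂ (π-dom s₂ e′)))
      ...   | nothing with G (π s₁ y)
      ...     | just _ = e₁
      ...     | nothing = refl

      pull-right : ∀ G → (∀ {x} → x ∈Dom G → x ∈Dom H₂) → pull G (π s₂) h₂ ≗ pull G π∪ h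
      pull-right G sub y with h₁ y in e₁
      ... | nothing with G (π s₂ y)
      ...   | nothing = refl
      ...   | just _ with d y
      ...     | inj₁ (e , e′) = trans e′ (trans (sym e₁) (sym e))
      ...     | inj₂ (e , _)  = sym e
      pull-right G sub y | just p with G (π s₁ y) in g
      ... | just _ = ⊥-elim (union-disjoint D (proj₂ (π-dom s₁ e₁)) (proj₂ (sub (_ , g))))
      ... | nothing with G (π s₂ y)
      ...   | nothing = refl
      ...   | just _ with h₂ y in e₂
      ...     | just _ = ⊥-elim (union-disjoint d e₁ e₂)
      ...     | nothing = refl

    -- The far clauses speak of several cells of `H` at once; `foreign` shows that these cells all
    -- lie in the same half, whose own clause then applies.
    Simulates-∪ : Simulates h H
    Simulates-∪ .π = π∪
    Simulates-∪ .π-dom e with union-split d e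
    ... | inj₁ e₁ rewrite π∪-left e₁ = let p , q = π-dom s₁ e₁ in p , union-⊆ˡ D q
    ... | inj₂ e₂ rewrite π∪-right e₂ = let p , q = π-dom s₂ e₂ in p , union-⊆ʳ D q
    Simulates-∪ .π-low e le with union-split d e
    ... | inj₁ e₁ rewrite π∪-left e₁ = π-low s₁ e₁ le
    ... | inj₂ e₂ rewrite π∪-right e₂ = π-low s₂ e₂ le
    Simulates-∪ .low E a<B with union-split D E
    ... | inj₁ E₁ = let πa , b , c , e , r = low s₁ E₁ a<B in trans (π∪-left e) πa , b , c , union-⊆ˡ d e , r
    ... | inj₂ E₂ = let πa , b , c , e , r = low s₂ E₂ a<B in trans (π∪-right e) πa , b , c , union-⊆ʳ d e , r
    Simulates-∪ .far-end E le with union-split D E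
    ... | inj₁ E₁ = far-end s₁ E₁ le
    ... | inj₂ E₂ = far-end s₂ E₂ le
    Simulates-∪ .far-ls Ef le Ea a<B G dom with union-split D Ef | union-split D Ea
    ... | inj₁ Ef | inj₁ Ea = let k , p = far-ls s₁ Ef le Ea a<B G dom in
      k , lsK-≗ k (pull-left G λ {x} g → [ (λ { refl → _ , Ea }) , (λ { refl → _ , Ef }) ]′ (to (dom x) g)) p
    ... | inj₂ Ef | inj₂ Ea = let k , p = far-ls s₂ Ef le Ea a<B G dom in
      k , lsK-≗ k (pull-right G λ {x} g → [ (λ { refl → _ , Ea }) , (λ { refl → _ , Ef }) ]′ (to (dom x) g)) p
    ... | inj₁ Ef | inj₂ Ea = ⊥-elim (foreign (proj₁ (contents r₂ Ea)) le r₁ Ef λ o o′ → Own-disjoint o′ o)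
    ... | inj₂ Ef | inj₁ Ea = ⊥-elim (foreign (proj₁ (contents r₁ Ea)) le r₂ Ef Own-disjoint)
    Simulates-∪ .far-dll Ef le Ea a<B Eb with union-split D Ef | union-split D Ea | union-split D Eb
    ... | inj₁ Ef | inj₁ Ea | inj₁ Eb = let e<B , seg = far-dll s₁ Ef le Ea a<B Eb in e<B , λ G dom →
      let k , p = seg G dom in
      k , dllK-≗ k (pull-left G λ {x} g → [ (λ { refl → _ , Ea }) , [ (λ { refl → _ , Ef }) , (λ { refl → _ , Eb }) ]′ ]′ (to (dom x) g)) p
    ... | inj₂ Ef | inj₂ Ea | inj₂ Eb = let e<B , seg = far-dll s₂ Ef le Ea a<B Eb in e<B , λ G dom →
      let k , p = seg G dom in
      k , dllK-≗ k (pull-right G λ {x} g → [ (λ { refl → _ , Ea }) , [ (λ { refl → _ , Ef }) , (λ { refl → _ , Eb }) ]′ ]′ (to (dom x) g)) p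
    ... | inj₁ Ef | inj₂ Ea | _ = ⊥-elim (foreign (proj₁ (contents r₂ Ea)) le r₁ Ef λ o o′ → Own-disjoint o′ o)
    ... | inj₂ Ef | inj₁ Ea | _ = ⊥-elim (foreign (proj₁ (contents r₁ Ea)) le r₂ Ef Own-disjoint)
    ... | inj₁ Ef | _ | inj₂ Eb = ⊥-elim (foreign (proj₂ (contents r₂ Eb)) le r₁ Ef λ o o′ → Own-disjoint o′ o)
    ... | inj₂ Ef | _ | inj₁ Eb = ⊥-elim (foreign (proj₂ (contents r₁ Eb)) le r₂ Ef Own-disjoint)

  module _ {a b f z w h p r H H₁ H₂} (a<B : a < B) (b<B : b < B) (B≤f : B ≤ f)
           (d : DisjUnion h p r) (hp : PtsSem a z w p) (seg : ∃ λ k → lsK k a b h)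
           (D : DisjUnion H H₁ H₂) (Hp₁ : PtsSem a f B H₁) (Hp₂ : PtsSem f b B H₂) where

    private
      πls : ℕ → ℕ
      πls y with y ≟ a
      ... | yes _ = a
      ... | no _  = f

      πls-cases : ∀ y → (y ≡ a × πls y ≡ a) ⊎ πls y ≡ f
      πls-cases y with y ≟ a
      ... | yes e = inj₁ (e , refl)
      ... | no _  = inj₂ refl

      πls-a : πls a ≡ a
      πls-a with a ≟ a
      ... | yes _ = refl
      ... | no ≢  = ⊥-elim (≢ refl)

      H-cases : ∀ {x q} → H x ≡ just q → (x ≡ a × q ≡ (f , B)) ⊎ (x ≡ f × q ≡ (b , B))
      H-cases e = Sum.map (pts⁻ Hp₁) (pts⁻ Hp₂) (union-split D e)

      whole : ∀ G → (∀ x → x ∈Dom G ⇔ (x ≡ a ⊎ x ≡ f)) → h ≗ pull G πls h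
      whole G dom y with πls-cases y
      ... | inj₁ (_ , e) = go (from (dom (πls y)) (inj₁ e))
        where
        go : πls y ∈Dom G → h y ≡ pull G πls h y
        go (q , g) with G (πls y)
        go (q , refl) | just _ = refl
      ... | inj₂ e = go (from (dom (πls y)) (inj₂ e))
        where
        go : πls y ∈Dom G → h y ≡ pull G πls h y
        go (q , g) with G (πls y)
        go (q , refl) | just _ = refl

    -- `π` fixes `a` and sends every other address to `f`. As `f` holds junk in its second field, it
    -- never points back to a small address, which makes `far-dll` vacuous.
    Simulates-ls : Simulates h H
    Simulates-ls .π = πls
    Simulates-ls .π-dom {y} e with πls-cases y
    ... | inj₁ (_ , πy) rewrite πy = _ , union-⊆ˡ D (proj₁ Hp₁)
    ... | inj₂ πy rewrite πy = _ , union-⊆ʳ D (proj₁ Hp₂)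
    Simulates-ls .π-low {y} e le with πls-cases y
    ... | inj₁ (refl , πy) = sym πy
    ... | inj₂ πy rewrite πy = ⊥-elim (<⇒≱ le B≤f)
    Simulates-ls .low E x<B with H-cases E
    ... | inj₁ (refl , refl) = πls-a , z , w , union-⊆ˡ d (proj₁ hp) , (λ f<B → ⊥-elim (<⇒≱ f<B B≤f)) , (λ B<B → ⊥-elim (<-irrefl refl B<B))
    ... | inj₂ (refl , _) = ⊥-elim (<⇒≱ x<B B≤f)
    Simulates-ls .far-end E le with H-cases E
    ... | inj₁ (refl , _) = ⊥-elim (<⇒≱ a<B le)
    ... | inj₂ (_ , refl) = b<B
    Simulates-ls .far-ls Ef le Ea x<B G dom with H-cases Ef | H-cases Ea
    ... | inj₁ (refl , _) | _ = ⊥-elim (<⇒≱ a<B le)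
    ... | inj₂ _ | inj₂ (refl , _) = ⊥-elim (<⇒≱ x<B B≤f)
    ... | inj₂ (refl , refl) | inj₁ (refl , refl) = proj₁ seg , lsK-≗ (proj₁ seg) (whole G dom) (proj₂ seg)
    Simulates-ls .far-dll Ef le Ea x<B _ with H-cases Ef
    ... | inj₁ (refl , _) = ⊥-elim (<⇒≱ a<B le)
    ... | inj₂ (_ , refl) = ⊥-elim (<-irrefl refl x<B)

  module _ {a b c d f z e h p r pre last H H₁ H′ H₂ H₃}
           (a<B : a < B) (b<B : b < B) (c<B : c < B) (B≤f : B ≤ f)
           (du : DisjUnion h p r) (hp : PtsSem a z d p)
           (du′ : DisjUnion r pre last) (seg : ∃ λ k → dllK k z c e a pre) (hl : PtsSem c b e last)
           (whole-seg : ∃ λ k → dllK k a b c d h)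
           (D : DisjUnion H H₁ H′) (Hp₁ : PtsSem a f d H₁)
           (D′ : DisjUnion H′ H₂ H₃) (Hp₂ : PtsSem f c a H₂) (Hp₃ : PtsSem c b f H₃) where

    private
      πdll : ℕ → ℕ
      πdll y with y ≟ a | y ≟ c
      ... | yes _ | _     = a
      ... | no _  | yes _ = c
      ... | no _  | no _  = f

      πdll-cases : ∀ y → (y ≡ a × πdll y ≡ a) ⊎ (y ≡ c × πdll y ≡ c) ⊎ (y ≢ a × y ≢ c × πdll y ≡ f)
      πdll-cases y with y ≟ a | y ≟ c
      ... | yes e | _     = inj₁ (e , refl)
      ... | no _  | yes e = inj₂ (inj₁ (e , refl))
      ... | no n  | no m  = inj₂ (inj₂ (n , m , refl))

      a≢c : a ≢ c
      a≢c refl = union-disjoint du (proj₁ hp) (union-⊆ʳ du′ (proj₁ hl))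

      πdll-a : πdll a ≡ a
      πdll-a with πdll-cases a
      ... | inj₁ (_ , e) = e
      ... | inj₂ (inj₁ (e , _)) = ⊥-elim (a≢c e)
      ... | inj₂ (inj₂ (n , _)) = ⊥-elim (n refl)

      πdll-c : πdll c ≡ c
      πdll-c with πdll-cases c
      ... | inj₁ (e , _) = ⊥-elim (a≢c (sym e))
      ... | inj₂ (inj₁ (_ , e)) = e
      ... | inj₂ (inj₂ (_ , n , _)) = ⊥-elim (n refl)

      f≢ : ∀ {x} → x < B → x ≢ f
      f≢ x<B refl = <⇒≱ x<B B≤f

      H-cases : ∀ {x q} → H x ≡ just q →
        (x ≡ a × q ≡ (f , d)) ⊎ (x ≡ f × q ≡ (c , a)) ⊎ (x ≡ c × q ≡ (b , f))
      H-cases e = Sum.map (pts⁻ Hp₁) (λ e → Sum.map (pts⁻ Hp₂) (pts⁻ Hp₃) (union-split D′ e)) (union-split D e)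

      g = p ∪ʰ pre
      dg : DisjUnion g p pre
      dg = proj₁ (union-assocˡ du du′)
      dgl : DisjUnion h g last
      dgl = proj₂ (union-assocˡ du du′)

      -- Over `a` and `f` alone lies the list without its last cell. An `ls` atom may cover just
      -- this part and leave the cell `c` to another atom.
      front : ∀ G → (∀ x → x ∈Dom G ⇔ (x ≡ a ⊎ x ≡ f)) → g ≗ pull G πdll h
      front G dom y with πdll-cases y
      front G dom y | inj₁ (refl , e) with from (dom y) (inj₁ refl)
      ... | q , gy = trans (union-⊆ˡ dg (proj₁ hp)) (sym (pull-just {πdll} {h} {G} (trans (cong G e) gy) (union-⊆ˡ du (proj₁ hp))))
      front G dom y | inj₂ (inj₁ (refl , e)) with G c in Gc
      ... | just _ = ⊥-elim ([ (λ c≡a → a≢c (sym c≡a)) , f≢ c<B ]′ (to (dom c) (_ , Gc)))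
      ... | nothing with g y in gy
      ...   | just _ = ⊥-elim (union-disjoint dgl gy (proj₁ hl))
      ...   | nothing = sym (pull-nothing {πdll} {h} {G} (trans (cong G e) Gc))
      front G dom y | inj₂ (inj₂ (y≢a , y≢c , e)) with from (dom f) (inj₂ refl)
      ... | q , Gf = trans g≡h (sym pull≡h)
        where
        g≡h : g y ≡ h y
        g≡h with dgl y
        ... | inj₁ (e , _) = sym e
        ... | inj₂ (e , n) with last y in ly
        ...   | just _ = ⊥-elim (y≢c (proj₁ (pts⁻ hl ly)))
        ...   | nothing = trans n (sym e)
        pull≡h : pull G πdll h y ≡ h y
        pull≡h with G (πdll y) | trans (cong G e) Gf
        ... | just _ | _ = refl

      whole : ∀ G → (∀ x → x ∈Dom G ⇔ (x ≡ a ⊎ x ≡ f ⊎ x ≡ c)) → h ≗ pull G πdll h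
      whole G dom y = go (from (dom (πdll y)) (cases (πdll-cases y)))
        where
        cases : _ → πdll y ≡ a ⊎ πdll y ≡ f ⊎ πdll y ≡ c
        cases (inj₁ (_ , e)) = inj₁ e
        cases (inj₂ (inj₁ (_ , e))) = inj₂ (inj₂ e)
        cases (inj₂ (inj₂ (_ , _ , e))) = inj₂ (inj₁ e)
        go : πdll y ∈Dom G → h y ≡ pull G πdll h y
        go (q , g) with G (πdll y)
        go (q , refl) | just _ = refl

      front-ls : ∃ λ k → lsK k a c g
      front-ls = let k , s = seg in suc k , inj₂ (z , d , p , pre , dg , hp , dll⇒ls k s)

    -- The two named cells `a` and `c` are fixed by `π` and the middle collapses to `f`. For
    -- `far-ls` the back pointers of the front part are forgotten; for `far-dll` the three cells
    -- stand for the whole list.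
    Simulates-dll : Simulates h H
    Simulates-dll .π = πdll
    Simulates-dll .π-dom {y} e with πdll-cases y
    ... | inj₁ (_ , πy) rewrite πy = _ , union-⊆ˡ D (proj₁ Hp₁)
    ... | inj₂ (inj₁ (_ , πy)) rewrite πy = _ , union-⊆ʳ D (union-⊆ʳ D′ (proj₁ Hp₃))
    ... | inj₂ (inj₂ (_ , _ , πy)) rewrite πy = _ , union-⊆ʳ D (union-⊆ˡ D′ (proj₁ Hp₂))
    Simulates-dll .π-low {y} e le with πdll-cases y
    ... | inj₁ (refl , πy) = sym πy
    ... | inj₂ (inj₁ (refl , πy)) = sym πy
    ... | inj₂ (inj₂ (_ , _ , πy)) = ⊥-elim (f≢ le πy)
    Simulates-dll .low E x<B with H-cases E
    ... | inj₁ (refl , refl) = πdll-a , z , d , union-⊆ˡ du (proj₁ hp) , (λ f<B → ⊥-elim (<⇒≱ f<B B≤f)) , λ _ → refl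
    ... | inj₂ (inj₁ (refl , _)) = ⊥-elim (<⇒≱ x<B B≤f)
    ... | inj₂ (inj₂ (refl , refl)) = πdll-c , b , e , union-⊆ʳ du (union-⊆ʳ du′ (proj₁ hl)) , (λ _ → refl) , λ f<B → ⊥-elim (<⇒≱ f<B B≤f)
    Simulates-dll .far-end E le with H-cases E
    ... | inj₁ (refl , _) = ⊥-elim (<⇒≱ a<B le)
    ... | inj₂ (inj₁ (_ , refl)) = c<B
    ... | inj₂ (inj₂ (refl , _)) = ⊥-elim (<⇒≱ c<B le)
    Simulates-dll .far-ls Ef le Ea x<B G dom with H-cases Ef | H-cases Ea
    ... | inj₁ (refl , _) | _ = ⊥-elim (<⇒≱ a<B le)
    ... | inj₂ (inj₂ (refl , _)) | _ = ⊥-elim (<⇒≱ c<B le)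
    ... | inj₂ (inj₁ _) | inj₂ (inj₁ (refl , _)) = ⊥-elim (<⇒≱ x<B B≤f)
    ... | inj₂ (inj₁ (refl , _)) | inj₂ (inj₂ (_ , f≡b)) = ⊥-elim (f≢ b<B (sym (,-injectiveˡ f≡b)))
    ... | inj₂ (inj₁ (refl , refl)) | inj₁ (refl , refl) =
      proj₁ front-ls , lsK-≗ (proj₁ front-ls) (front G dom) (proj₂ front-ls)
    Simulates-dll .far-dll Ef le Ea x<B Eb with H-cases Ef | H-cases Ea | H-cases Eb
    ... | inj₁ (refl , _) | _ | _ = ⊥-elim (<⇒≱ a<B le)
    ... | inj₂ (inj₂ (refl , _)) | _ | _ = ⊥-elim (<⇒≱ c<B le)
    ... | inj₂ (inj₁ _) | inj₂ (inj₁ (refl , _)) | _ = ⊥-elim (<⇒≱ x<B B≤f)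
    ... | inj₂ (inj₁ (refl , _)) | inj₂ (inj₂ (_ , f≡b)) | _ = ⊥-elim (f≢ b<B (sym (,-injectiveˡ f≡b)))
    ... | inj₂ (inj₁ (refl , refl)) | inj₁ (refl , refl) | inj₁ (e , _) = ⊥-elim (a≢c (sym e))
    ... | inj₂ (inj₁ (refl , refl)) | inj₁ (refl , refl) | inj₂ (inj₁ (e , _)) = ⊥-elim (f≢ c<B e)
    ... | inj₂ (inj₁ (refl , refl)) | inj₁ (refl , refl) | inj₂ (inj₂ (_ , refl)) =
      b<B , λ G dom → proj₁ whole-seg , dllK-≗ (proj₁ whole-seg) (whole G dom) (proj₂ whole-seg)

-- Every model is simulated by one of the unfoldings

module _ (s : Store) (Bₜ : Term) where
  open Reading s (⟦ Bₜ ⟧t s)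
  open Unfolding Bₜ
  open Simulation ⟦ Bₜ ⟧
  open Simulating ⟦ Bₜ ⟧

  private
    B = ⟦ Bₜ ⟧

    far-own : ∀ i → Own i (i + 1) ⟦ farₜ i ⟧
    far-own i = +-monoʳ-< B ≤-refl , ≤-reflexive (cong (B +_) (+-comm 1 i))

    B≤far : ∀ i → B ≤ ⟦ farₜ i ⟧
    B≤far i = m≤m+n B (suc i)

  unfold-ranged : ∀ i F c → Small s F → Ranged i (i + atoms F) (read (unfold i F c))
  unfold-ranged i Emp c _ = Ranged-∅
  unfold-ranged i (t ↦⟨ u , v ⟩) c (t<B , u<B , v<B) =
    Ranged-pts (read-cell t u v) (inj₁ t<B) (inj₁ (<⇒≤ u<B)) (inj₁ (<⇒≤ v<B))
  unfold-ranged i (Arr t u) c (t<B , u<B) = record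
    { addresses = λ e → inj₁ (≤-<-trans (proj₂ (proj₁ (read-arr⁻ t u e))) u<B)
    ; contents = λ e → content (proj₂ (read-arr⁻ t u e)) }
    where
    content : ∀ {b c} → (b , c) ≡ (B , B) → (b ≤ B ⊎ Own i (i + 1) b) × (c ≤ B ⊎ Own i (i + 1) c)
    content refl = inj₁ ≤-refl , inj₁ ≤-refl
  unfold-ranged i (ls t u) zero _ = Ranged-∅
  unfold-ranged i (ls t u) (suc zero) (t<B , u<B) =
    Ranged-pts (read-cell t u Bₜ) (inj₁ t<B) (inj₁ (<⇒≤ u<B)) (inj₁ ≤-refl)
  unfold-ranged i (ls t u) (suc (suc _)) (t<B , u<B) = Ranged-∪
    (Ranged-pts (read-cell t (farₜ i) Bₜ) (inj₁ t<B) (inj₂ (far-own i)) (inj₁ ≤-refl))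
    (Ranged-pts (read-cell (farₜ i) u Bₜ) (inj₂ (far-own i)) (inj₁ (<⇒≤ u<B)) (inj₁ ≤-refl))
  unfold-ranged i (dll t u v w) zero _ = Ranged-∅
  unfold-ranged i (dll t u v w) (suc zero) (t<B , u<B , v<B , w<B) =
    Ranged-pts (read-cell t u w) (inj₁ t<B) (inj₁ (<⇒≤ u<B)) (inj₁ (<⇒≤ w<B))
  unfold-ranged i (dll t u v w) (suc (suc zero)) (t<B , u<B , v<B , w<B) = Ranged-∪
    (Ranged-pts (read-cell t v w) (inj₁ t<B) (inj₁ (<⇒≤ v<B)) (inj₁ (<⇒≤ w<B)))
    (Ranged-pts (read-cell v u t) (inj₁ v<B) (inj₁ (<⇒≤ u<B)) (inj₁ (<⇒≤ t<B)))
  unfold-ranged i (dll t u v w) (suc (suc (suc _))) (t<B , u<B , v<B , w<B) = Ranged-∪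
    (Ranged-pts (read-cell t (farₜ i) w) (inj₁ t<B) (inj₂ (far-own i)) (inj₁ (<⇒≤ w<B)))
    (Ranged-∪
      (Ranged-pts (read-cell (farₜ i) v t) (inj₂ (far-own i)) (inj₁ (<⇒≤ v<B)) (inj₁ (<⇒≤ t<B)))
      (Ranged-pts (read-cell v u (farₜ i)) (inj₁ v<B) (inj₁ (<⇒≤ u<B)) (inj₂ (far-own i))))
  unfold-ranged i (F ✶ G) (c , d) (sF , sG) = Ranged-∪
    (Ranged-weaken ≤-refl (+-monoʳ-≤ i (m≤m+n (atoms F) (atoms G))) (unfold-ranged i F c sF))
    (Ranged-weaken (m≤m+n i (atoms F)) (≤-reflexive (+-assoc i (atoms F) (atoms G)))
      (unfold-ranged (i + atoms F) G d sG))

  private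
    pts-disjoint : ∀ {a b c a′ b′ c′ g h} → a ≢ a′ → PtsSem a b c g → PtsSem a′ b′ c′ h → Disjoint g h
    pts-disjoint a≢ p q e e′ = a≢ (trans (sym (proj₁ (pts⁻ p e))) (proj₁ (pts⁻ q e′)))

    small≢far : ∀ {x} i → x < B → x ≢ ⟦ farₜ i ⟧
    small≢far i x<B refl = <⇒≱ x<B (B≤far i)

    Simulates-pts : ∀ {a b c b′ c′ h H} → a < B → PtsSem a b c h → PtsSem a b′ c′ H →
      (b′ < B → b ≡ b′) → (c′ < B → c ≡ c′) → Simulates h H
    Simulates-pts a<B hp Hp eb ec = Simulates-exact
      (λ e → let x≡a , _ = pts⁻ hp e in _ , trans (cong _ x≡a) (proj₁ Hp))
      (λ e → subst (_< B) (sym (proj₁ (pts⁻ Hp e))) a<B)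
      (λ e → content (pts⁻ Hp e))
      where
      content : ∀ {x p} → x ≡ _ × p ≡ _ → _
      content (refl , refl) = _ , _ , proj₁ hp , eb , ec

  Unfolds : ℕ → Spatial → RawHeap → Set
  Unfolds i F h = Σ (Choice F) λ c →
    ⟦ condₚ F c ⟧p s × ⟦ wfₚ (unfold i F c) ⟧p s × Simulates h (read (unfold i F c))

  private
    ls-complete : ∀ {h} i t u k → ⟦ t ⟧ < B → ⟦ u ⟧ < B → lsK k ⟦ t ⟧ ⟦ u ⟧ h → Unfolds i (ls t u) h
    ls-complete i t u zero _ _ (ff , _) = ⊥-elim (ff refl)
    ls-complete i t u (suc k) t<B u<B (inj₁ (t≡u , emp)) = zero , t≡u , refl ,
      Simulates-exact (λ e → ⊥-elim (just≢nothing e (emp _))) (λ ()) (λ ())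
    ls-complete i t u (suc zero) t<B u<B (inj₂ (z , w , p , r , d , hp , (ff , _))) = ⊥-elim (ff refl)
    ls-complete i t u (suc (suc k)) t<B u<B (inj₂ (z , w , p , r , d , hp , inj₁ (refl , emp))) =
      suc zero , refl , refl ,
      Simulates-pts t<B (PtsSem-≗ (sym ∘ union-emptyʳ d emp) hp) (read-cell t u Bₜ)
        (λ _ → refl) (λ B<B → ⊥-elim (<-irrefl refl B<B))
    ls-complete i t u (suc (suc k)) t<B u<B whole@(inj₂ (z , w , p , r , d , hp , inj₂ _)) =
      suc (suc zero) , refl , disjoint-wf (t ↦⟨ farₜ i , Bₜ ⟩) (farₜ i ↦⟨ u , Bₜ ⟩) refl refl apart ,
      Simulates-ls t<B u<B (B≤far i) d hp (suc (suc k) , whole)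
        (∪-DisjUnion apart) (read-cell t (farₜ i) Bₜ) (read-cell (farₜ i) u Bₜ)
      where
      apart : Disjoint (read (t ↦⟨ farₜ i , Bₜ ⟩)) (read (farₜ i ↦⟨ u , Bₜ ⟩))
      apart = pts-disjoint (small≢far i t<B) (read-cell t (farₜ i) Bₜ) (read-cell (farₜ i) u Bₜ)

    dll-complete : ∀ {h} i t u v w k → Small s (dll t u v w) →
      dllK k ⟦ t ⟧ ⟦ u ⟧ ⟦ v ⟧ ⟦ w ⟧ h → Unfolds i (dll t u v w) h
    dll-complete i t u v w zero _ (ff , _) = ⊥-elim (ff refl)
    dll-complete i t u v w (suc k) _ (inj₁ (t≡u , v≡w , emp)) = zero , (t≡u , v≡w) , refl ,
      Simulates-exact (λ e → ⊥-elim (just≢nothing e (emp _))) (λ ()) (λ ())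
    dll-complete i t u v w (suc zero) _ (inj₂ (z , p , r , d , hp , (ff , _))) = ⊥-elim (ff refl)
    dll-complete i t u v w (suc (suc k)) (t<B , _) (inj₂ (z , p , r , d , hp , inj₁ (refl , v≡t , emp))) =
      suc zero , sym v≡t , refl ,
      Simulates-pts t<B (PtsSem-≗ (sym ∘ union-emptyʳ d emp) hp) (read-cell t u w) (λ _ → refl) (λ _ → refl)
    -- The tail `r` is nonempty, so its last cell can be split off. The list has exactly two cells
    -- if the remainder `pre` is empty, and at least three otherwise.
    dll-complete i t u v w (suc (suc k)) sm whole@(inj₂ (z , p , r , d , hp , inj₂ (z′ , p′ , r′ , d′ , hp′ , rest)))
      with dll-unsnoc k d′ hp′ rest
    dll-complete i t u v w _ sm whole@(inj₂ (z , p , r , d , hp , inj₂ (z′ , p′ , r′ , d′ , hp′ , rest)))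
      | e , pre , last , d″ , (zero , (ff , _)) , hl = ⊥-elim (ff refl)
    dll-complete {h} i t u v w _ (t<B , u<B , v<B , w<B) whole@(inj₂ (z , p , r , d , hp , inj₂ (z′ , p′ , r′ , d′ , hp′ , rest)))
      | e , pre , last , d″ , (suc j , inj₁ (refl , refl , emp)) , hl =
      suc (suc zero) , refl , disjoint-wf (t ↦⟨ v , w ⟩) (v ↦⟨ u , t ⟩) refl refl apart ,
      Simulates-exact dom small cont
      where
      hl′ : PtsSem ⟦ v ⟧ ⟦ u ⟧ ⟦ t ⟧ r
      hl′ = PtsSem-≗ (sym ∘ union-emptyˡ d″ emp) hl
      apart : Disjoint (read (t ↦⟨ v , w ⟩)) (read (v ↦⟨ u , t ⟩))
      apart = pts-disjoint (λ t≡v → union-disjoint d (proj₁ hp) (trans (cong r t≡v) (proj₁ hl′)))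
        (read-cell t v w) (read-cell v u t)
      D : DisjUnion (read ((t ↦⟨ v , w ⟩) ✶ (v ↦⟨ u , t ⟩))) (read (t ↦⟨ v , w ⟩)) (read (v ↦⟨ u , t ⟩))
      D = ∪-DisjUnion apart
      dom : ∀ {x q} → h x ≡ just q → x ∈Dom (read (t ↦⟨ v , w ⟩) ∪ʰ read (v ↦⟨ u , t ⟩))
      dom E with union-split d E
      ... | inj₁ E with pts⁻ hp E
      ...   | refl , _ = _ , union-⊆ˡ D (proj₁ (read-cell t v w))
      dom E | inj₂ E′ with pts⁻ hl′ E′
      ...   | refl , _ = _ , union-⊆ʳ D (proj₁ (read-cell v u t))
      small : ∀ {x q} → (read (t ↦⟨ v , w ⟩) ∪ʰ read (v ↦⟨ u , t ⟩)) x ≡ just q → x < B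
      small {x} E with union-split D E
      ... | inj₁ E with read-cell⁻ t v w {x} E
      ...   | refl , _ = t<B
      small {x} E | inj₂ E′ with read-cell⁻ v u t {x} E′
      ...   | refl , _ = v<B
      cont : ∀ {x b c} → (read (t ↦⟨ v , w ⟩) ∪ʰ read (v ↦⟨ u , t ⟩)) x ≡ just (b , c) →
        ∃₂ λ b′ c′ → h x ≡ just (b′ , c′) × (b < B → b′ ≡ b) × (c < B → c′ ≡ c)
      cont {x} E with union-split D E
      ... | inj₁ E with read-cell⁻ t v w {x} E
      ...   | refl , refl = _ , _ , union-⊆ˡ d (proj₁ hp) , (λ _ → refl) , (λ _ → refl)
      cont {x} E | inj₂ E′ with read-cell⁻ v u t {x} E′
      ...   | refl , refl = _ , _ , union-⊆ʳ d (proj₁ hl′) , (λ _ → refl) , (λ _ → refl)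
    dll-complete i t u v w _ (t<B , u<B , v<B , w<B) whole@(inj₂ (z , p , r , d , hp , inj₂ (z′ , p′ , r′ , d′ , hp′ , rest)))
      | e , pre , last , d″ , seg@(suc j , inj₂ _) , hl =
      suc (suc (suc zero)) , refl ,
      disjoint-wf T (Fa ✶ V) refl (disjoint-wf Fa V refl refl apart′) apart ,
      Simulates-dll t<B u<B v<B (B≤far i) d hp d″ seg hl (_ , whole)
        (∪-DisjUnion apart) (read-cell t (farₜ i) w)
        D′ (read-cell (farₜ i) v t) (read-cell v u (farₜ i))
      where
      T Fa V : Spatial
      T  = t ↦⟨ farₜ i , w ⟩
      Fa = farₜ i ↦⟨ v , t ⟩
      V  = v ↦⟨ u , farₜ i ⟩
      t≢v : ⟦ t ⟧ ≢ ⟦ v ⟧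
      t≢v t≡v = union-disjoint d (proj₁ hp) (trans (cong r t≡v) (union-⊆ʳ d″ (proj₁ hl)))
      apart′ : Disjoint (read Fa) (read V)
      apart′ = pts-disjoint (λ f≡v → small≢far i v<B (sym f≡v)) (read-cell (farₜ i) v t) (read-cell v u (farₜ i))
      D′ : DisjUnion (read (Fa ✶ V)) (read Fa) (read V)
      D′ = ∪-DisjUnion apart′
      apart : Disjoint (read T) (read (Fa ✶ V))
      apart E E′ with union-split D′ E′
      ... | inj₁ E″ = pts-disjoint (small≢far i t<B) (read-cell t (farₜ i) w) (read-cell (farₜ i) v t) E E″
      ... | inj₂ E″ = pts-disjoint t≢v (read-cell t (farₜ i) w) (read-cell v u (farₜ i)) E E″

  unfold-complete : ∀ {h} i F → Small s F → s , h ⊨ₛ F → Unfolds i F h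
  unfold-complete i Emp _ emp = tt , refl , refl ,
    Simulates-exact (λ e → ⊥-elim (just≢nothing e (emp _))) (λ ()) (λ ())
  unfold-complete i (t ↦⟨ u , v ⟩) (t<B , _) pts = tt , refl , refl ,
    Simulates-pts t<B pts (read-cell t u v) (λ _ → refl) (λ _ → refl)
  unfold-complete {h} i (Arr t u) (t<B , u<B) (t≤u , f) = tt , refl , t≤u ,
    Simulates-exact
      (λ {x} e → let l , r = proj₁ (f x) (_ , e) in _ , read-arr t u l r)
      (λ e → ≤-<-trans (proj₂ (proj₁ (read-arr⁻ t u e))) u<B)
      (λ {a} e → let lr , q = read-arr⁻ t u e in cont (proj₂ (f a) lr) q)
    where
    cont : ∀ {a b c} → a ∈Dom h → (b , c) ≡ (B , B) →
      ∃₂ λ b′ c′ → h a ≡ just (b′ , c′) × (b < B → b′ ≡ b) × (c < B → c′ ≡ c)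
    cont ((b′ , c′) , e) refl = b′ , c′ , e , (λ B<B → ⊥-elim (<-irrefl refl B<B)) , (λ B<B → ⊥-elim (<-irrefl refl B<B))
  unfold-complete i (ls t u) (t<B , u<B) (k , p) = ls-complete i t u k t<B u<B p
  unfold-complete i (dll t u v w) sm (k , p) = dll-complete i t u v w k sm p
  unfold-complete i (F ✶ G) (sF , sG) (h₁ , h₂ , d , p , q)
    with unfold-complete i F sF p | unfold-complete (i + atoms F) G sG q
  ... | c , cF , wF , simF | c′ , cG , wG , simG =
    (c , c′) , (cF , cG) , disjoint-wf (unfold i F c) (unfold (i + atoms F) G c′) wF wG apart ,
    Simulates-∪ d (∪-DisjUnion apart) rF rG simF simG
    where
    rF = unfold-ranged i F c sF
    rG = unfold-ranged (i + atoms F) G c′ sG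
    apart : Disjoint (read (unfold i F c)) (read (unfold (i + atoms F) G c′))
    apart = Simulates-disjoint rF rG simF simG (union-disjoint d)

-- Model checking canonical heaps

-- The cells traversed by a list segment, each number indexing the cells not yet used.
data Path : ℕ → Set where
  stop : ∀ {n} → Path n
  step : ∀ {n} → Fin (suc n) → Path n → Path (suc n)

-- The finite data behind a satisfaction proof: the listed cell used by each points-to atom and the
-- cells crossed by each list atom. Arrays need no data, since their end points determine their
-- region.
Certificate : ℕ → Spatial → Set
Certificate n (t ↦⟨ u , v ⟩) = Fin n
Certificate n (ls t u) = Path n
Certificate n (dll t u v w) = Path n
Certificate n (F ✶ G) = Certificate n F × Certificate n G
Certificate n _ = ⊤

_without_ : ∀ {n} → (Fin (suc n) → Cell) → Fin (suc n) → Fin n → Cell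
(C without i) j = C (punchIn i j)

addressₜ firstₜ secondₜ : Cell → Term
addressₜ (t , u , v) = t
firstₜ (t , u , v) = u
secondₜ (t , u , v) = v

point : Term → Region
point t = (t , t) ∷ []

pathRegion : ∀ {n} → (Fin n → Cell) → Path n → Region
pathRegion C stop = []
pathRegion C (step i p) = point (addressₜ (C i)) ++ pathRegion (C without i) p

lsₚ : ∀ {n} → (Fin n → Cell) → Path n → Term → Term → Pure
lsₚ C stop t u = t =ₚ u
lsₚ C (step i p) t u = (t =ₚ addressₜ (C i)) ∧ₚ
  (lsₚ (C without i) p (firstₜ (C i)) u ∧ₚ disjointₚ (point (addressₜ (C i))) (pathRegion (C without i) p))

dllₚ : ∀ {n} → (Fin n → Cell) → Path n → Term → Term → Term → Term → Pure
dllₚ C stop t u v w = (t =ₚ u) ∧ₚ (v =ₚ w)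
dllₚ C (step i p) t u v w = ((t =ₚ addressₜ (C i)) ∧ₚ (w =ₚ secondₜ (C i))) ∧ₚ
  (dllₚ (C without i) p (firstₜ (C i)) u v t ∧ₚ disjointₚ (point (addressₜ (C i))) (pathRegion (C without i) p))

certRegion : ∀ {n} → (Fin n → Cell) → ∀ F → Certificate n F → Region
certRegion C Emp c = []
certRegion C (t ↦⟨ u , v ⟩) c = point t
certRegion C (Arr t u) c = (t , u) ∷ []
certRegion C (ls t u) p = pathRegion C p
certRegion C (dll t u v w) p = pathRegion C p
certRegion C (F ✶ G) (c , d) = certRegion C F c ++ certRegion C G d

-- Only contents and mutual disjointness are checked here. That the claimed regions exhaust the heap
-- is the second half of `checkₚ`.
certₚ : ∀ {n} → (Fin n → Cell) → ∀ F → Certificate n F → Pure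
certₚ C Emp c = ⊤ₚ
certₚ C (t ↦⟨ u , v ⟩) i = (t =ₚ addressₜ (C i)) ∧ₚ ((u =ₚ firstₜ (C i)) ∧ₚ (v =ₚ secondₜ (C i)))
certₚ C (Arr t u) c = t ≤ₚ u
certₚ C (ls t u) p = lsₚ C p t u
certₚ C (dll t u v w) p = dllₚ C p t u v w
certₚ C (F ✶ G) (c , d) = (certₚ C F c ∧ₚ certₚ C G d) ∧ₚ disjointₚ (certRegion C F c) (certRegion C G d)

module Checking (s : Store) (J : ℕ) where
  open Reading s J
  open Simulation J using (Small)

  Occupies : Region → RawHeap → Set
  Occupies r h = ∀ x → x ∈Dom h ⇔ InRegion s r x

  Covers : ∀ {n} → (Fin n → Cell) → RawHeap → Set
  Covers C h = ∀ {a b c} → h a ≡ just (b , c) → b ≢ J → ∃ λ i → Denotes a b c (C i)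

  inside outside : Region → RawHeap → RawHeap
  inside r h x with inRegion? s r x
  ... | yes _ = h x
  ... | no _  = nothing
  outside r h x with inRegion? s r x
  ... | yes _ = nothing
  ... | no _  = h x

  inside-outside : ∀ r h → DisjUnion h (inside r h) (outside r h)
  inside-outside r h x with inRegion? s r x
  ... | yes _ = inj₁ (refl , refl)
  ... | no _  = inj₂ (refl , refl)

  Occupies-∪ : ∀ {r r′ h h₁ h₂} → DisjUnion h h₁ h₂ → Occupies r h₁ → Occupies r′ h₂ → Occupies (r ++ r′) h
  Occupies-∪ {r} d o o′ x = mk⇔
    (λ (q , e) → [ (λ e → ++⁺ˡ (to (o x) (q , e))) , (λ e → ++⁺ʳ r (to (o′ x) (q , e))) ]′ (union-split d e))
    (λ i → [ (λ i → let q , e = from (o x) i in q , union-⊆ˡ d e)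
           , (λ i → let q , e = from (o′ x) i in q , union-⊆ʳ d e) ]′ (++⁻ r i))

  Occupies-disjoint : ∀ {r r′ h h₁ h₂} → DisjUnion h h₁ h₂ → Occupies r h₁ → Occupies r′ h₂ → ⟦ disjointₚ r r′ ⟧p s
  Occupies-disjoint {r} {r′} d o o′ = from (⟦disjointₚ⟧ s r r′) λ x i i′ →
    union-disjoint d (proj₂ (from (o x) i)) (proj₂ (from (o′ x) i′))

  Occupies-inside : ∀ r r′ h → Occupies (r ++ r′) h → Occupies r (inside r h)
  Occupies-inside r r′ h o x with inRegion? s r x
  ... | yes i = mk⇔ (λ _ → i) (λ _ → from (o x) (++⁺ˡ i))
  ... | no ¬i = mk⇔ (λ ()) (λ i → ⊥-elim (¬i i))

  Occupies-outside : ∀ r r′ h → ⟦ disjointₚ r r′ ⟧p s → Occupies (r ++ r′) h → Occupies r′ (outside r h)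
  Occupies-outside r r′ h d o x with inRegion? s r x
  ... | yes i = mk⇔ (λ ()) (λ i′ → ⊥-elim (to (⟦disjointₚ⟧ s r r′) d x i i′))
  ... | no ¬i = mk⇔ (λ p → [ (λ i → ⊥-elim (¬i i)) , id ]′ (++⁻ r (to (o x) p))) (λ i′ → from (o x) (++⁺ʳ r i′))

  Occupies-point : ∀ {a b c h} t → a ≡ ⟦ t ⟧ → PtsSem a b c h → Occupies (point t) h
  Occupies-point {h = h} t refl (e , u) x = mk⇔ (λ p → in-point (u x p)) out
    where
    in-point : x ≡ ⟦ t ⟧ → InRegion s (point t) x
    in-point refl = here (≤-refl , ≤-refl)
    out : InRegion s (point t) x → x ∈Dom h
    out (here (p , q)) with ≤-antisym p q
    ... | refl = _ , e

  point-pts : ∀ {h H} c → h ⊆ʰ H → Stores H c → Occupies (point (addressₜ c)) h →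
    PtsSem ⟦ addressₜ c ⟧ ⟦ firstₜ c ⟧ ⟦ secondₜ c ⟧ h
  point-pts {h} (t , u , v) h⊆H e o = here-t (from (o ⟦ t ⟧) (here (≤-refl , ≤-refl))) , λ x p → unique x (to (o x) p)
    where
    here-t : ⟦ t ⟧ ∈Dom h → h ⟦ t ⟧ ≡ just (⟦ u ⟧ , ⟦ v ⟧)
    here-t (q , e′) with just-unique (h⊆H e′) e
    ... | refl = e′
    unique : ∀ x → InRegion s (point t) x → x ≡ ⟦ t ⟧
    unique x (here (p , q)) = ≤-antisym q p

  -- A cell of `h₂` cannot be the one listed under `i`, whose address is taken by `h₁`.
  Covers-without : ∀ {n} {C : Fin (suc n) → Cell} {h h₁ h₂ a b c} i → DisjUnion h h₁ h₂ → PtsSem a b c h₁ →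
    Denotes a b c (C i) → Covers C h → Covers (C without i) h₂
  Covers-without {C = C} i d pts (a≡ , _) cov {x} e b≢J with cov (union-⊆ʳ d e) b≢J
  ... | j , den@(x≡ , _) with i Fin.≟ j
  ...   | yes refl = ⊥-elim (union-disjoint d (proj₁ pts) (trans (cong _ (trans a≡ (sym x≡))) e))
  ...   | no i≢j = punchOut i≢j , subst (Denotes _ _ _ ∘ C) (sym (punchIn-punchOut i≢j)) den

  private
    -- The address `J` is unallocated and is not the end of the list, so no list continues from it.
    -- Hence the cells crossed by a list have a first field other than `J` and, by `Covers`, are
    -- among the listed ones.
    not-junk-ls : ∀ k {z b h} → h J ≡ nothing → b ≢ J → lsK k z b h → z ≢ J
    not-junk-ls zero _ _ (ff , _) = ⊥-elim (ff refl)
    not-junk-ls (suc k) _ b≢J (inj₁ (refl , _)) = b≢J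
    not-junk-ls (suc k) hJ _ (inj₂ (_ , _ , _ , _ , d , pts , _)) refl = just≢nothing (union-⊆ˡ d (proj₁ pts)) hJ

    union-nothing : ∀ {h h₁ h₂ x} → DisjUnion h h₁ h₂ → h x ≡ nothing → h₁ x ≡ nothing × h₂ x ≡ nothing
    union-nothing {x = x} d e with d x
    ... | inj₁ (e₁ , n) = trans (sym e₁) e , n
    ... | inj₂ (e₂ , n) = n , trans (sym e₂) e

  -- Separation makes the crossed cells distinct. Each step uses up one listed cell, which bounds
  -- the length of the path by `n`, whatever `k` is.
  ls-certificate : ∀ n (C : Fin n → Cell) k {a h} t u → a ≡ ⟦ t ⟧ → h J ≡ nothing → ⟦ u ⟧ ≢ J → Covers C h →
    lsK k a ⟦ u ⟧ h → ∃ λ p → ⟦ lsₚ C p t u ⟧p s × Occupies (pathRegion C p) h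
  ls-certificate n C zero t u _ _ _ _ (ff , _) = ⊥-elim (ff refl)
  ls-certificate n C (suc k) t u refl _ _ _ (inj₁ (e , emp)) =
    stop , e , λ x → mk⇔ (λ (_ , q) → ⊥-elim (just≢nothing q (emp x))) λ ()
  ls-certificate n C (suc k) t u refl hJ uJ cov (inj₂ (z , w , h₁ , h₂ , d , pts , rest))
    with cov (union-⊆ˡ d (proj₁ pts)) (not-junk-ls k (proj₂ (union-nothing d hJ)) uJ rest)
  ls-certificate (suc n) C (suc k) t u refl hJ uJ cov (inj₂ (z , w , h₁ , h₂ , d , pts , rest))
    | i , den@(a≡ , z≡ , w≡)
    with ls-certificate n (C without i) k (firstₜ (C i)) u z≡ (proj₂ (union-nothing d hJ)) uJ
           (Covers-without {C = C} i d pts den cov) rest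
  ... | p , cond , occ = step i p , (a≡ , cond , Occupies-disjoint d (Occupies-point (addressₜ (C i)) a≡ pts) occ)
      , Occupies-∪ d (Occupies-point (addressₜ (C i)) a≡ pts) occ

  dll-certificate : ∀ n (C : Fin n → Cell) k {a w′ h} t u v w → a ≡ ⟦ t ⟧ → w′ ≡ ⟦ w ⟧ → h J ≡ nothing → ⟦ u ⟧ ≢ J →
    Covers C h → dllK k a ⟦ u ⟧ ⟦ v ⟧ w′ h → ∃ λ p → ⟦ dllₚ C p t u v w ⟧p s × Occupies (pathRegion C p) h
  dll-certificate n C zero t u v w _ _ _ _ _ (ff , _) = ⊥-elim (ff refl)
  dll-certificate n C (suc k) t u v w refl refl _ _ _ (inj₁ (e , e′ , emp)) =
    stop , (e , e′) , λ x → mk⇔ (λ (_ , q) → ⊥-elim (just≢nothing q (emp x))) λ ()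
  dll-certificate n C (suc k) t u v w refl refl hJ uJ cov (inj₂ (z , h₁ , h₂ , d , pts , rest))
    with cov (union-⊆ˡ d (proj₁ pts)) (not-junk-ls k (proj₂ (union-nothing d hJ)) uJ (dll⇒ls k rest))
  dll-certificate (suc n) C (suc k) t u v w refl refl hJ uJ cov (inj₂ (z , h₁ , h₂ , d , pts , rest))
    | i , den@(a≡ , z≡ , w≡)
    with dll-certificate n (C without i) k (firstₜ (C i)) u v t z≡ refl (proj₂ (union-nothing d hJ)) uJ
           (Covers-without {C = C} i d pts den cov) rest
  ... | p , cond , occ = step i p , ((a≡ , w≡) , cond , Occupies-disjoint d (Occupies-point (addressₜ (C i)) a≡ pts) occ)
      , Occupies-∪ d (Occupies-point (addressₜ (C i)) a≡ pts) occ

  certify : ∀ {n h} (C : Fin n → Cell) F → Small s F → h J ≡ nothing → Covers C h → s , h ⊨ₛ F →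
    ∃ λ c → ⟦ certₚ C F c ⟧p s × Occupies (certRegion C F c) h
  certify C Emp _ _ _ emp = tt , refl , λ x → mk⇔ (λ (_ , q) → ⊥-elim (just≢nothing q (emp x))) λ ()
  certify C (t ↦⟨ u , v ⟩) (_ , u<J , _) _ cov pts with cov (proj₁ pts) (<⇒≢ u<J)
  ... | i , den = i , den , Occupies-point t refl pts
  certify C (Arr t u) _ _ _ (t≤u , f) = tt , t≤u , λ x → mk⇔
    (λ p → here (proj₁ (f x) p)) (λ { (here q) → proj₂ (f x) q ; (there ()) })
  certify C (ls t u) (_ , u<J) hJ cov (k , p) = ls-certificate _ C k t u refl hJ (<⇒≢ u<J) cov p
  certify C (dll t u v w) (_ , u<J , _) hJ cov (k , p) = dll-certificate _ C k t u v w refl refl hJ (<⇒≢ u<J) cov p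
  certify C (F ✶ G) (sF , sG) hJ cov (h₁ , h₂ , d , p , q)
    with certify C F sF (proj₁ (union-nothing d hJ)) (λ e → cov (union-⊆ˡ d e)) p
       | certify C G sG (proj₂ (union-nothing d hJ)) (λ e → cov (union-⊆ʳ d e)) q
  ... | c , cc , o | c′ , cc′ , o′ = (c , c′) , ((cc , cc′) , Occupies-disjoint d o o′) , Occupies-∪ d o o′

  module _ {H : RawHeap} where

    -- The splitting required by `lsK` is rebuilt from the regions with `inside` and `outside`, and
    -- the contents of the cells are read off the ambient heap `H`.
    ls-certified : ∀ {n h} (C : Fin n → Cell) p t u → h ⊆ʰ H → (∀ i → Stores H (C i)) → ⟦ lsₚ C p t u ⟧p s →
      Occupies (pathRegion C p) h → ∃ λ k → lsK k ⟦ t ⟧ ⟦ u ⟧ h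
    ls-certified {h = h} C stop t u h⊆H st e o = 1 , inj₁ (e , emp)
      where
      emp : EmpSem h
      emp x with h x in eq
      ... | nothing = refl
      ... | just _ with to (o x) (_ , eq)
      ...   | ()
    ls-certified {h = h} C (step i p) t u h⊆H st (t≡ , cond , disj) o =
      let P = point (addressₜ (C i))
          R = pathRegion (C without i) p
          d = inside-outside P h
          k , rest = ls-certified (C without i) p (firstₜ (C i)) u (λ e → h⊆H (union-⊆ʳ d e)) (λ j → st (punchIn i j)) cond
                       (Occupies-outside P R h disj o)
          pts = point-pts (C i) (λ e → h⊆H (union-⊆ˡ d e)) (st i) (Occupies-inside P R h o)
      in suc k , inj₂ (_ , _ , _ , _ , d , subst (λ a → PtsSem a ⟦ firstₜ (C i) ⟧ ⟦ secondₜ (C i) ⟧ (inside P h)) (sym t≡) pts , rest)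

    dll-certified : ∀ {n h} (C : Fin n → Cell) p t u v w → h ⊆ʰ H → (∀ i → Stores H (C i)) → ⟦ dllₚ C p t u v w ⟧p s →
      Occupies (pathRegion C p) h → ∃ λ k → dllK k ⟦ t ⟧ ⟦ u ⟧ ⟦ v ⟧ ⟦ w ⟧ h
    dll-certified {h = h} C stop t u v w h⊆H st (e , e′) o = 1 , inj₁ (e , e′ , emp)
      where
      emp : EmpSem h
      emp x with h x in eq
      ... | nothing = refl
      ... | just _ with to (o x) (_ , eq)
      ...   | ()
    dll-certified {h = h} C (step i p) t u v w h⊆H st ((t≡ , w≡) , cond , disj) o =
      let P = point (addressₜ (C i))
          R = pathRegion (C without i) p
          d = inside-outside P h
          k , rest = dll-certified (C without i) p (firstₜ (C i)) u v t (λ e → h⊆H (union-⊆ʳ d e)) (λ j → st (punchIn i j)) cond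
                       (Occupies-outside P R h disj o)
          pts = point-pts (C i) (λ e → h⊆H (union-⊆ˡ d e)) (st i) (Occupies-inside P R h o)
      in suc k , inj₂ (_ , _ , _ , d , subst₂ (λ a c → PtsSem a ⟦ firstₜ (C i) ⟧ c (inside P h)) (sym t≡) (sym w≡) pts , rest)

    certified : ∀ {n h} (C : Fin n → Cell) F c → h ⊆ʰ H → (∀ i → Stores H (C i)) → ⟦ certₚ C F c ⟧p s →
      Occupies (certRegion C F c) h → s , h ⊨ₛ F
    certified {h = h} C Emp c _ _ _ o x with h x in eq
    ... | nothing = refl
    ... | just _ with to (o x) (_ , eq)
    ...   | ()
    certified {h = h} C (t ↦⟨ u , v ⟩) i h⊆H st (t≡ , u≡ , v≡) o =
      subst₂ (λ b c → PtsSem ⟦ t ⟧ b c h) (sym u≡) (sym v≡)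
        (point-pts (t , firstₜ (C i) , secondₜ (C i)) h⊆H (trans (cong H t≡) (st i)) o)
    certified C (Arr t u) c _ _ t≤u o = t≤u , λ x →
      (λ p → in-arr (to (o x) p)) , λ q → from (o x) (here q)
      where
      in-arr : ∀ {x} → InRegion s ((t , u) ∷ []) x → ⟦ t ⟧ ≤ x × x ≤ ⟦ u ⟧
      in-arr (here q) = q
    certified C (ls t u) p h⊆H st cond o = ls-certified C p t u h⊆H st cond o
    certified C (dll t u v w) p h⊆H st cond o = dll-certified C p t u v w h⊆H st cond o
    certified {h = h} C (F ✶ G) (c , c′) h⊆H st ((cond , cond′) , disj) o =
      let R = certRegion C F c
          R′ = certRegion C G c′
          d = inside-outside R h
      in inside R h , outside R h , d
         , certified C F c (λ e → h⊆H (union-⊆ˡ d e)) st cond (Occupies-inside R R′ h o)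
         , certified C G c′ (λ e → h⊆H (union-⊆ʳ d e)) st cond′ (Occupies-outside R R′ h disj o)

-- Assembling the Presburger sentence

anyₚ allₚ : {A : Set} → (A → Pure) → List A → Pure
anyₚ f [] = ⊥ₚ
anyₚ f (x ∷ xs) = f x ∨ₚ anyₚ f xs
allₚ f [] = ⊤ₚ
allₚ f (x ∷ xs) = f x ∧ₚ allₚ f xs

⟦anyₚ⟧ : ∀ {A s} (f : A → Pure) xs → ⟦ anyₚ f xs ⟧p s ⇔ Any (λ x → ⟦ f x ⟧p s) xs
⟦anyₚ⟧ f [] = mk⇔ (λ ()) (λ ())
⟦anyₚ⟧ f (x ∷ xs) = mk⇔
  [ here , (λ p → there (to (⟦anyₚ⟧ f xs) p)) ]′
  (λ { (here p) → inj₁ p ; (there p) → inj₂ (from (⟦anyₚ⟧ f xs) p) })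

⟦allₚ⟧ : ∀ {A s} (f : A → Pure) xs → ⟦ allₚ f xs ⟧p s ⇔ (∀ x → x ∈ xs → ⟦ f x ⟧p s)
⟦allₚ⟧ f [] = mk⇔ (λ _ _ ()) (λ _ → refl)
⟦allₚ⟧ f (x ∷ xs) = mk⇔
  (λ { (p , ps) _ (here refl) → p ; (p , ps) y (there y∈) → to (⟦allₚ⟧ f xs) ps y y∈ })
  (λ g → g x (here refl) , from (⟦allₚ⟧ f xs) (λ y y∈ → g y (there y∈)))

Listed : Set → Set
Listed A = Σ (List A) λ xs → ∀ x → x ∈ xs

listed-⊤ : Listed ⊤
listed-⊤ = tt ∷ [] , λ _ → here refl

listed-Fin : ∀ n → Listed (Fin n)
listed-Fin n = allFin n , ∈-allFin

listed-× : ∀ {A B} → Listed A → Listed B → Listed (A × B)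
listed-× (xs , f) (ys , g) = cartesianProduct xs ys , λ (x , y) → ∈-cartesianProduct⁺ (f x) (g y)

listed-Path : ∀ n → Listed (Path n)
listed-Path zero = stop ∷ [] , λ { stop → here refl }
listed-Path (suc n) with listed-Path n
... | ps , f = stop ∷ cartesianProductWith step (allFin (suc n)) ps ,
  λ { stop → here refl ; (step i p) → there (∈-cartesianProductWith⁺ step (∈-allFin i) (f p)) }

certificates : ∀ n F → Listed (Certificate n F)
certificates n Emp = listed-⊤
certificates n (t ↦⟨ u , v ⟩) = listed-Fin n
certificates n (Arr t u) = listed-⊤
certificates n (ls t u) = listed-Path n
certificates n (dll t u v w) = listed-Path n
certificates n (F ✶ G) = listed-× (certificates n F) (certificates n G)

-- Terms are built with addition only, so a sum takes the place of a maximum: over the naturals it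
-- bounds each summand.
sumₜ : Spatial → Term
sumₜ Emp = lit 0
sumₜ (t ↦⟨ u , v ⟩) = t ⊕ (u ⊕ v)
sumₜ (Arr t u) = t ⊕ u
sumₜ (ls t u) = t ⊕ u
sumₜ (dll t u v w) = (t ⊕ u) ⊕ (v ⊕ w)
sumₜ (F ✶ G) = sumₜ F ⊕ sumₜ G

private
  +-<⁻ : ∀ m {n o} → m + n < o → m < o × n < o
  +-<⁻ m {n} lt = ≤-<-trans (m≤m+n m n) lt , ≤-<-trans (m≤n+m n m) lt

sumₜ-small : ∀ {B} s F → ⟦ sumₜ F ⟧t s < B → Simulation.Small B s F
sumₜ-small s Emp _ = tt
sumₜ-small s (t ↦⟨ u , v ⟩) lt = Prod.map₂ (+-<⁻ (⟦ u ⟧t s)) (+-<⁻ (⟦ t ⟧t s) lt)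
sumₜ-small s (Arr t u) lt = +-<⁻ (⟦ t ⟧t s) lt
sumₜ-small s (ls t u) lt = +-<⁻ (⟦ t ⟧t s) lt
sumₜ-small s (dll t u v w) lt =
  let tu , vw = +-<⁻ (⟦ t ⟧t s + ⟦ u ⟧t s) lt
      t<B , u<B = +-<⁻ (⟦ t ⟧t s) tu
  in t<B , u<B , +-<⁻ (⟦ v ⟧t s) vw
sumₜ-small s (F ✶ G) lt = Prod.map (sumₜ-small s F) (sumₜ-small s G) (+-<⁻ (⟦ sumₜ F ⟧t s) lt)

sumₜ-all : List QFSH → Term
sumₜ-all [] = lit 0
sumₜ-all (ψ ∷ ψs) = sumₜ (QFSH.spatial ψ) ⊕ sumₜ-all ψs

sumₜ-all-small : ∀ {B} s ψs → ⟦ sumₜ-all ψs ⟧t s < B → ∀ {ψ} → ψ ∈ ψs → Simulation.Small B s (QFSH.spatial ψ)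
sumₜ-all-small s (ψ ∷ ψs) lt (here refl) = sumₜ-small s (QFSH.spatial ψ) (proj₁ (+-<⁻ (⟦ sumₜ (QFSH.spatial ψ) ⟧t s) lt))
sumₜ-all-small s (ψ ∷ ψs) lt (there ψ∈) = sumₜ-all-small s ψs (proj₂ (+-<⁻ (⟦ sumₜ (QFSH.spatial ψ) ⟧t s) lt)) ψ∈

module Entailment (φ : QFSH) (ψs : List QFSH) where
  open QFSH

  -- Exceeds the value of every spatial term of the entailment.
  Bₜ : Term
  Bₜ = (sumₜ (spatial φ) ⊕ sumₜ-all ψs) ⊕ lit 1

  open Unfolding Bₜ

  choices : ∀ F → Listed (Choice F)
  choices Emp = listed-⊤
  choices (t ↦⟨ u , v ⟩) = listed-⊤
  choices (Arr t u) = listed-⊤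
  choices (ls t u) = listed-Fin 3
  choices (dll t u v w) = listed-Fin 4
  choices (F ✶ G) = listed-× (choices F) (choices G)

  unfolded : Choice (spatial φ) → Spatial
  unfolded = unfold 0 (spatial φ)

  -- Says that the canonical heap for `c` is a genuine heap and a model of `φ`; the last conjunct
  -- keeps address `0` unallocated, as `Heap` demands.
  hypothesisₚ : Choice (spatial φ) → Pure
  hypothesisₚ c = pure φ ∧ₚ (condₚ (spatial φ) c ∧ₚ (wfₚ (unfolded c) ∧ₚ disjointₚ (point (lit 0)) (region (unfolded c))))

  cellAt : ∀ F → Fin (List.length (cells F)) → Cell
  cellAt F = List.lookup (cells F)

  checkₚ : ∀ F (ψ : QFSH) → Certificate (List.length (cells F)) (spatial ψ) → Pure
  checkₚ F ψ d = certₚ (cellAt F) (spatial ψ) d ∧ₚ sameₚ (region F) (certRegion (cellAt F) (spatial ψ) d)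

  satisfiesₚ : Spatial → QFSH → Pure
  satisfiesₚ F ψ = pure ψ ∧ₚ anyₚ (checkₚ F ψ) (proj₁ (certificates (List.length (cells F)) (spatial ψ)))

  caseₚ : Choice (spatial φ) → Pure
  caseₚ c = (¬ₚ hypothesisₚ c) ∨ₚ anyₚ (satisfiesₚ (unfolded c)) ψs

  validₚ : Pure
  validₚ = allₚ caseₚ (proj₁ (choices (spatial φ)))

  module _ (s : Store) where
    open Reading s (⟦ Bₜ ⟧t s)
    open Checking s (⟦ Bₜ ⟧t s)
    open Simulation ⟦ Bₜ ⟧
    open Simulating ⟦ Bₜ ⟧ using (Ranged; Own-≮)

    private
      B = ⟦ Bₜ ⟧

      sum<B : ⟦ sumₜ (spatial φ) ⟧ + ⟦ sumₜ-all ψs ⟧ < B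
      sum<B = ≤-reflexive (+-comm 1 _)

      small-φ : Small s (spatial φ)
      small-φ = sumₜ-small s (spatial φ) (proj₁ (+-<⁻ ⟦ sumₜ (spatial φ) ⟧ sum<B))

      small-ψ : ∀ {ψ} → ψ ∈ ψs → Small s (spatial ψ)
      small-ψ = sumₜ-all-small s ψs (proj₂ (+-<⁻ ⟦ sumₜ (spatial φ) ⟧ sum<B))

      0<B : 0 < B
      0<B = ≤-<-trans z≤n sum<B

      read-B : ∀ c → read (unfolded c) B ≡ nothing
      read-B c with read (unfolded c) B in eq
      ... | nothing = refl
      ... | just _ with Ranged.addresses (unfold-ranged s Bₜ 0 (spatial φ) c small-φ) eq
      ...   | inj₁ B<B = ⊥-elim (<-irrefl refl B<B)
      ...   | inj₂ o = ⊥-elim (Own-≮ o ≤-refl)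

      read-covers : ∀ F → Covers (cellAt F) (read F)
      read-covers F e b≢B with read-denoted F e b≢B
      ... | any = Any.index any , lookup-index any

      read-stores : ∀ F → ⟦ wfₚ F ⟧p s → ∀ i → Stores (read F) (cellAt F i)
      read-stores F wf i = read-cells F wf _ (∈-lookup i)

      satisfies : ∀ c ψ → ψ ∈ ψs → ⟦ wfₚ (unfolded c) ⟧p s →
        ⟦ satisfiesₚ (unfolded c) ψ ⟧p s ⇔ (⟦ pure ψ ⟧p s × s , read (unfolded c) ⊨ₛ spatial ψ)
      satisfies c ψ ψ∈ wf = mk⇔ (λ (p , q) → p , sound (to any⇔ q)) (λ (p , q) → p , from any⇔ (complete q))
        where
        F = unfolded c
        C = cellAt F
        certs = certificates (List.length (cells F)) (spatial ψ)
        any⇔ = ⟦anyₚ⟧ {s = s} (checkₚ F ψ) (proj₁ certs)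
        sound : Any (λ d → ⟦ checkₚ F ψ d ⟧p s) (proj₁ certs) → s , read F ⊨ₛ spatial ψ
        sound any with find any
        ... | d , _ , cond , same = certified {read F} C (spatial ψ) d id (read-stores F wf) cond
          λ x → to (⟦sameₚ⟧ s (region F) (certRegion C (spatial ψ) d)) same x ⇔-∘ ⟦region⟧ F x
        complete : s , read F ⊨ₛ spatial ψ → Any (λ d → ⟦ checkₚ F ψ d ⟧p s) (proj₁ certs)
        complete sat with certify C (spatial ψ) (small-ψ ψ∈) (read-B c) (read-covers F) sat
        ... | d , cond , occ = lose (proj₂ certs d)
          (cond , from (⟦sameₚ⟧ s (region F) (certRegion C (spatial ψ) d)) λ x → occ x ⇔-∘ ⇔-sym (⟦region⟧ F x))

    validₚ-sound : ⟦ validₚ ⟧p s → ∀ h → s , h ⊨ φ → Any (λ ψ → s , h ⊨ ψ) ψs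
    validₚ-sound valid h (p , sat) with unfold-complete s Bₜ 0 (spatial φ) small-φ sat
    ... | c , cond , wf , sim with to (⟦allₚ⟧ caseₚ (proj₁ (choices (spatial φ)))) valid c (proj₂ (choices (spatial φ)) c)
    ...   | inj₁ ¬hyp = ⊥-elim (¬hyp (p , cond , wf , from (⟦disjointₚ⟧ s (point (lit 0)) (region (unfolded c))) no-zero))
      where
      no-zero : ∀ x → InRegion s (point (lit 0)) x → InRegion s (region (unfolded c)) x → ⊥
      no-zero .0 (here (_ , z≤n)) i with region-read (unfolded c) 0 i
      -- Address `0` lies below `B`, so if the canonical heap allocated it, `h` would allocate it
      -- too.
      ... | _ , e with Simulates.low sim e 0<B
      ...   | _ , _ , _ , e′ , _ = just≢nothing e′ (zeroOut h)
    ...   | inj₂ any with find (to (⟦anyₚ⟧ (satisfiesₚ (unfolded c)) ψs) any)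
    ...     | ψ , ψ∈ , satₚ = let q , sat′ = to (satisfies c ψ ψ∈ wf) satₚ in
      lose ψ∈ (q , Transfer.transfer-whole sim (spatial ψ) (small-ψ ψ∈) sat′)

    -- Validity is applied only to canonical heaps: `hypothesisₚ c` turns the one for `c` into a
    -- heap satisfying `φ`.
    validₚ-complete : (∀ h → s , h ⊨ φ → Any (λ ψ → s , h ⊨ ψ) ψs) → ⟦ validₚ ⟧p s
    validₚ-complete valid = from (⟦allₚ⟧ caseₚ (proj₁ (choices (spatial φ)))) λ c _ → holds c (pure? (hypothesisₚ c) s)
      where
      holds : ∀ c → Dec (⟦ hypothesisₚ c ⟧p s) → ⟦ caseₚ c ⟧p s
      holds c (no ¬hyp) = inj₁ ¬hyp
      holds c (yes (p , cond , wf , no-zero)) = inj₂ (from (⟦anyₚ⟧ (satisfiesₚ (unfolded c)) ψs) satisfied)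
        where
        H : Heap
        H .fun = read (unfolded c)
        H .zeroOut with read (unfolded c) 0 in eq
        ... | nothing = refl
        ... | just _ = ⊥-elim (to (⟦disjointₚ⟧ s (point (lit 0)) (region (unfolded c))) no-zero 0
                         (here (z≤n , z≤n)) (read-region (unfolded c) 0 (_ , eq)))
        H .finite = read-finite (unfolded c)
        satisfied : Any (λ ψ → ⟦ satisfiesₚ (unfolded c) ψ ⟧p s) ψs
        satisfied with find (valid H (p , unfold-sound 0 (spatial φ) c cond (read-sat (unfolded c) wf)))
        ... | ψ , ψ∈ , sat = lose ψ∈ (from (satisfies c ψ ψ∈ wf) sat)

theorem8p1 : (φ : QFSH) (φs : List QFSH) → Dec (Valid φ φs)
theorem8p1 φ φs = map′
  (λ valid s → validₚ-sound s (valid s))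
  (λ valid s → validₚ-complete s (valid s))
  (presburger validₚ)
  where open Entailment φ φs
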